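{- Let $N\ge 3$. The monoid $\operatorname{NDPF}^{(1)}_N$ of affine non-decreasing parking functions is $\mathcal{J}$-trivial, and it is isomorphic to the quotient of the $0$-Hecke monoid $H_0(\tilde S_N)$ by the relations $\pi_j\pi_{j+1}\pi_j=\pi_j\pi_{j+1}$ for all $j\in\mathbb{Z}/N\mathbb{Z}$. Moreover, each fiber of the quotient map $H_0(\tilde S_N)\to H_0(\tilde S_N)/(\pi_j\pi_{j+1}\pi_j=\pi_j\pi_{j+1})$, viewed as a set of affine permutations via $w\mapsto\pi_w$, contains a unique $[321]$-avoiding affine permutation.
   Context: The affine symmetric group $\tilde S_N$ is the group of bijections $\sigma:\mathbb{Z}\to\mathbb{Z}$ with $\sigma(i+N)=\sigma(i)+N$ for all $i$ and $\sum_{i=1}^N\sigma(i)=\binom{N+1}{2}$. It is generated by $s_0,\dots,s_{N-1}$, where $s_i$ exchanges $j$ and $j+1$ for every $j\equiv i \pmod N$; indices are taken mod $N$, with relations $s_i^2=1$, $s_is_j=s_js_i$ when $i,j$ are not adjacent mod $N$, $s_is_{i+1}s_i=s_{i+1}s_is_{i+1}$. The $0$-Hecke monoid $H_0(\tilde S_N)$ is generated by $\pi_i$ ($i\in\mathbb{Z}/N$) with $\pi_i^2=\pi_i$ and the same commutation and braid relations; its elements are $\pi_w=\pi_{i_1}\cdots\pi_{i_k}$ for reduced words $w=s_{i_1}\cdots s_{i_k}$, in bijection with $\tilde S_N$. An affine permutation $x$ contains $[321]$ if there are integers $a<b<c$ with $x(a)>x(b)>x(c)$; otherwise it is $[321]$-avoiding.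 $\operatorname{NDPF}^{(1)}_N$ is the set of functions $f:\mathbb{Z}\to\mathbb{Z}$ that are regressive ($f(i)\le i$), order preserving ($i\le j\Rightarrow f(i)\le f(j)$) and skew periodic ($f(i+N)=f(i)+N$), excluding the shift functions $i\mapsto i-t$ for $t\neq 0$; it is a monoid under composition. A monoid $M$ is $\mathcal J$-trivial if $MfM=MgM$ implies $f=g$. -}

module Defs where

open import Level using (Level; _⊔_; 0ℓ)
open import Algebra.Bundles using (Monoid)
open import Algebra.Morphism.Structures using (module MonoidMorphisms)
open import Data.Bool.Base using (if_then_else_)
open import Data.Fin.Base using (Fin; toℕ; fromℕ<)
open import Data.Fin.Properties using (_≟_)
open import Data.Integer.Base using (ℤ; +_; 0ℤ; 1ℤ; _+_; _-_; -_; _*_; _≤_; _<_; ∣_∣)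
import Data.Integer.Base as ℤ
open import Data.Integer.DivMod using (_%ℕ_; n%ℕd<d)
import Data.Integer.Properties as ℤₚ
open import Data.Integer.Tactic.RingSolver using (solve-∀)
open import Data.List.Base using (List; []; _∷_; foldr; map; upTo; length)
open import Data.List.Properties using (++-monoid)
open import Data.Nat.Base as ℕ using (ℕ; zero; suc; NonZero)
open import Data.Nat.Combinatorics using (_C_)
open import Data.Nat.DivMod using (_mod_)
import Data.Nat.Properties as ℕₚ
open import Data.Product.Base using (_×_; _,_; ∃; ∃₂)
open import Function.Base using (id; _∘_)
open import Function.Definitions using (Bijective)
open import Relation.Binary.Core using (Rel)
open import Relation.Binary.PropositionalEquality
  using (_≡_; _≢_; _≗_; refl; sym; trans; cong; subst; subst₂)
open import Relation.Nullary using (¬_; does; yes; no)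
open import Relation.Unary using (Pred; _≐_)

private
  variable
    c ℓ c′ ℓ′ r : Level

module _ (M : Monoid c ℓ) where
  open Monoid M

  twoSidedIdeal : Carrier → Pred Carrier (c ⊔ ℓ)
  twoSidedIdeal f h = ∃₂ λ a b → h ≈ a ∙ f ∙ b

  J-Trivial : Set (c ⊔ ℓ)
  J-Trivial = ∀ f g → twoSidedIdeal f ≐ twoSidedIdeal g → f ≈ g

_≅_ : Monoid c ℓ → Monoid c′ ℓ′ → Set (c ⊔ ℓ ⊔ c′ ⊔ ℓ′)
M ≅ M′ = ∃ λ φ → IsMonoidIsomorphism φ
  where open MonoidMorphisms (Monoid.rawMonoid M) (Monoid.rawMonoid M′)

module _ (M : Monoid c ℓ) (R : Rel (Monoid.Carrier M) r) where
  open Monoid M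
    renaming (refl to ≈-refl; sym to ≈-sym; trans to ≈-trans)

  -- The least monoid congruence on M containing R.
  data Congruence : Rel Carrier (c ⊔ ℓ ⊔ r) where
    base    : ∀ {x y} → x ≈ y → Congruence x y
    gen     : ∀ {x y} → R x y → Congruence x y
    ~-sym   : ∀ {x y} → Congruence x y → Congruence y x
    ~-trans : ∀ {x y z} → Congruence x y → Congruence y z → Congruence x z
    ~-cong  : ∀ {x y u v} → Congruence x y → Congruence u v →
              Congruence (x ∙ u) (y ∙ v)

  -- Since Monoid carries its own equality, the quotient keeps the carrier
  -- and coarsens the equality; the quotient map is then the identity on
  -- representatives.
  quotient : Monoid c (c ⊔ ℓ ⊔ r)
  quotient = record
    { Carrier  = Carrier
    ; _≈_      = Congruence
    ; _∙_      = _∙_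
    ; ε        = ε
    ; isMonoid = record
      { isSemigroup = record
        { isMagma = record
          { isEquivalence = record
            { refl = base ≈-refl ; sym = ~-sym ; trans = ~-trans }
          ; ∙-cong = ~-cong
          }
        ; assoc = λ x y z → base (assoc x y z)
        }
      ; identity = (λ x → base (identityˡ x)) , (λ x → base (identityʳ x))
      }
    }

  quotientMap : Carrier → Monoid.Carrier quotient
  quotientMap = id

-- Fin N stands for ℤ/Nℤ; next is addition of 1.

module _ {N : ℕ} .{{_ : NonZero N}} where

  next : Fin N → Fin N
  next i = suc (toℕ i) mod N

  residue : ℤ → Fin N
  residue j = fromℕ< (n%ℕd<d j N)

SkewPeriodic : ℕ → (ℤ → ℤ) → Set
SkewPeriodic N f = ∀ i → f (i + + N) ≡ f i + + N

record AffinePermutation (N : ℕ) : Set where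
  field
    fun          : ℤ → ℤ
    bijective    : Bijective _≡_ _≡_ fun
    skewPeriodic : SkewPeriodic N fun
    sum≡         : foldr _+_ 0ℤ (map (λ k → fun (+ suc k)) (upTo N))
                   ≡ + (suc N C 2)

module _ {N : ℕ} where
  open AffinePermutation

  infix 4 _≈ₐ_
  _≈ₐ_ : Rel (AffinePermutation N) 0ℓ
  x ≈ₐ y = fun x ≗ fun y

  Contains321 : Pred (AffinePermutation N) 0ℓ
  Contains321 x = ∃ λ a → ∃ λ b → ∃ λ d →
    a < b × b < d × fun x d < fun x b × fun x b < fun x a

  Avoids321 : Pred (AffinePermutation N) 0ℓ
  Avoids321 x = ¬ Contains321 x

module _ {N : ℕ} .{{_ : NonZero N}} where
  open AffinePermutation

  simple : Fin N → ℤ → ℤ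
  simple i j =
    if does (residue j ≟ i) then j + 1ℤ
    else if does (residue j ≟ next i) then j - 1ℤ
    else j

  wordProduct : List (Fin N) → ℤ → ℤ
  wordProduct = foldr (λ i f → simple i ∘ f) id

  WordFor : List (Fin N) → AffinePermutation N → Set
  WordFor u x = wordProduct u ≗ fun x

  ReducedWordFor : List (Fin N) → AffinePermutation N → Set
  ReducedWordFor u x =
    WordFor u x × (∀ v → WordFor v x → length u ℕ.≤ length v)

module _ (N : ℕ) .{{_ : NonZero N}} where

  -- The word i₁ ∷ … ∷ iₖ ∷ [] stands for the product π_{i₁} ⋯ π_{iₖ}.
  data HeckeRelation : Rel (List (Fin N)) 0ℓ where
    idempotent : ∀ i → HeckeRelation (i ∷ i ∷ []) (i ∷ [])
    commute    : ∀ i j → j ≢ next i → i ≢ next j →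
                 HeckeRelation (i ∷ j ∷ []) (j ∷ i ∷ [])
    braid      : ∀ i → HeckeRelation (i ∷ next i ∷ i ∷ [])
                                     (next i ∷ i ∷ next i ∷ [])

  H₀ : Monoid 0ℓ 0ℓ
  H₀ = quotient (++-monoid (Fin N)) HeckeRelation

  private module H = Monoid H₀

  π : Fin N → H.Carrier
  π i = i ∷ []

  -- The graph of x ↦ π_x: h is the product of the π_i along a reduced word
  -- of x (by Matsumoto's theorem, independent of the word chosen).
  IsHecke : AffinePermutation N → H.Carrier → Set
  IsHecke x h = ∃ λ u → ReducedWordFor u x × h H.≈ foldr (λ i → π i H.∙_) H.ε u

  data ExtraRelation : Rel H.Carrier 0ℓ where
    extra : ∀ j → ExtraRelation (π j H.∙ π (next j) H.∙ π j)
                                (π j H.∙ π (next j))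

  H₀/extra : Monoid 0ℓ 0ℓ
  H₀/extra = quotient H₀ ExtraRelation

  Fiber : Monoid.Carrier H₀/extra → Pred (AffinePermutation N) 0ℓ
  Fiber q x = ∃ λ h → IsHecke x h × quotientMap H₀ ExtraRelation h ≈ q
    where open Monoid H₀/extra using (_≈_)

IsShift : ℤ → (ℤ → ℤ) → Set
IsShift t f = ∀ i → f i ≡ i - t

record NDPF (N : ℕ) : Set where
  field
    fun             : ℤ → ℤ
    regressive      : ∀ i → fun i ≤ i
    orderPreserving : ∀ {i j} → i ≤ j → fun i ≤ fun j
    skewPeriodic    : SkewPeriodic N fun
    notShift        : ∀ t → t ≢ 0ℤ → ¬ IsShift t fun

module _ (N : ℕ) .{{_ : NonZero N}} where
  open NDPF

  private
    module _ (g : ℤ → ℤ) (per : SkewPeriodic N g)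
             (incr : ∀ i → g i + 1ℤ ≤ g (i + 1ℤ)) where

      perⁿ : ∀ k i → g (i + + k * + N) ≡ g i + + k * + N
      perⁿ zero i = trans (cong g (ℤₚ.+-identityʳ i)) (sym (ℤₚ.+-identityʳ (g i)))
      perⁿ (suc k) i =
        trans (cong g (e i (+ k) (+ N)))
          (trans (per (i + + k * + N))
            (trans (cong (λ z → z + + N) (perⁿ k i)) (sym (e (g i) (+ k) (+ N)))))
        where
        e : ∀ a b d → a + (1ℤ + b) * d ≡ a + b * d + d
        e = solve-∀

      incrⁿ : ∀ k i → g i + + k ≤ g (i + + k)
      incrⁿ zero i = ℤₚ.≤-reflexive
        (trans (ℤₚ.+-identityʳ (g i)) (cong g (sym (ℤₚ.+-identityʳ i))))
      incrⁿ (suc k) i = subst₂ _≤_ (e (g i) (+ k)) (cong g (e i (+ k)))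
        (ℤₚ.≤-trans (ℤₚ.+-monoˡ-≤ 1ℤ (incrⁿ k i)) (incr (i + + k)))
        where
        e : ∀ a b → a + b + 1ℤ ≡ a + (1ℤ + b)
        e = solve-∀

      incr≤ : ∀ {i j} → i ≤ j → g i + (j - i) ≤ g j
      incr≤ {i} {j} i≤j =
        subst₂ _≤_ (cong (λ z → g i + z) p) (cong g (trans (cong (λ z → i + z) p) (e i j)))
          (incrⁿ ∣ j - i ∣ i)
        where
        p : + ∣ j - i ∣ ≡ j - i
        p = ℤₚ.0≤i⇒+∣i∣≡i (ℤₚ.i≤j⇒0≤j-i i≤j)
        e : ∀ a b → a + (b - a) ≡ b
        e = solve-∀

      i≤∣i∣ : ∀ i → i ≤ + ∣ i ∣
      i≤∣i∣ (+ n) = ℤₚ.≤-refl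
      i≤∣i∣ ℤ.-[1+ n ] = ℤ.-≤+

      far : ∀ i j → i ≤ j + + ∣ i - j ∣ * + N
      far i j = subst (_≤ j + + ∣ i - j ∣ * + N) (e i j)
        (ℤₚ.+-monoʳ-≤ j (ℤₚ.≤-trans (i≤∣i∣ (i - j))
          (subst (+ ∣ i - j ∣ ≤_) (ℤₚ.pos-* ∣ i - j ∣ N)
            (ℤ.+≤+ (ℕₚ.m≤m*n ∣ i - j ∣ N)))))
        where
        e : ∀ a b → b + (a - b) ≡ a
        e = solve-∀

      -- displacement is weakly increasing and periodic, hence constant
      incrAny : ∀ i j → g i + (j - i) ≤ g j
      incrAny i j = subst₂ _≤_ (e₁ (g i) j i K) (e₂ (g j) K)
        (ℤₚ.+-monoˡ-≤ (- K)
          (subst (g i + (j + K - i) ≤_) (perⁿ ∣ i - j ∣ j) (incr≤ (far i j))))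
        where
        K = + ∣ i - j ∣ * + N
        e₁ : ∀ a b d k → a + (b + k - d) - k ≡ a + (b - d)
        e₁ = solve-∀
        e₂ : ∀ a k → a + k - k ≡ a
        e₂ = solve-∀

      isShift : IsShift (- g 0ℤ) g
      isShift i = ℤₚ.≤-antisym
        (subst₂ _≤_ (e₁ (g i) i) (e₂ (g 0ℤ) i)
          (ℤₚ.+-monoˡ-≤ i (incrAny i 0ℤ)))
        (subst (_≤ g i) (e₃ (g 0ℤ) i) (incrAny 0ℤ i))
        where
        e₁ : ∀ a b → a + (0ℤ - b) + b ≡ a
        e₁ = solve-∀
        e₂ : ∀ a b → a + b ≡ b - - a
        e₂ = solve-∀
        e₃ : ∀ a b → a + (b - 0ℤ) ≡ b - - a
        e₃ = solve-∀

    right-shift : (f g : NDPF N) → ∀ t → IsShift t (fun f ∘ fun g) →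
                  IsShift (- fun g 0ℤ) (fun g)
    right-shift f g t fg = isShift (fun g) (skewPeriodic g) incr
      where
      lt : ∀ i → fun g i < fun g (i + 1ℤ)
      lt i = ℤₚ.≰⇒> λ le → ℤₚ.<⇒≱
        (ℤₚ.+-monoˡ-< (- t) (subst (i <_) (ℤₚ.+-comm 1ℤ i) (ℤₚ.suc[i]≤j⇒i<j ℤₚ.≤-refl)))
        (subst₂ _≤_ (fg (i + 1ℤ)) (fg i) (orderPreserving f le))
      incr : ∀ i → fun g i + 1ℤ ≤ fun g (i + 1ℤ)
      incr i = subst (_≤ fun g (i + 1ℤ)) (ℤₚ.+-comm 1ℤ (fun g i))
        (ℤₚ.i<j⇒suc[i]≤j (lt i))

    -- If f ∘ g is a shift then so is g; hence g is the identity, and f is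
    -- that same shift.
    ∘-notShift : (f g : NDPF N) → ∀ t → t ≢ 0ℤ → ¬ IsShift t (fun f ∘ fun g)
    ∘-notShift f g t t≢0 fg with - fun g 0ℤ ℤₚ.≟ 0ℤ
    ... | no ≢0 = notShift g _ ≢0 (right-shift f g t fg)
    ... | yes ≡0 = notShift f t t≢0 λ i → trans (cong (fun f) (sym (g≗id i))) (fg i)
      where
      g≗id : ∀ i → fun g i ≡ i
      g≗id i = trans (right-shift f g t fg i)
        (trans (cong (λ z → i - z) ≡0) (ℤₚ.+-identityʳ i))

    idNDPF : NDPF N
    idNDPF = record
      { fun             = id
      ; regressive      = λ _ → ℤₚ.≤-refl
      ; orderPreserving = id
      ; skewPeriodic    = λ _ → refl
      ; notShift        = λ t t≢0 sh → t≢0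
          (trans (sym (ℤₚ.neg-involutive t))
            (cong -_ (trans (sym (ℤₚ.+-identityˡ (- t))) (sym (sh 0ℤ)))))
      }

    _⊙_ : NDPF N → NDPF N → NDPF N
    f ⊙ g = record
      { fun             = fun f ∘ fun g
      ; regressive      = λ i → ℤₚ.≤-trans (regressive f (fun g i)) (regressive g i)
      ; orderPreserving = orderPreserving f ∘ orderPreserving g
      ; skewPeriodic    = λ i →
          trans (cong (fun f) (skewPeriodic g i)) (skewPeriodic f (fun g i))
      ; notShift        = ∘-notShift f g
      }

  NDPF-monoid : Monoid 0ℓ 0ℓ
  NDPF-monoid = record
    { Carrier  = NDPF N
    ; _≈_      = λ f g → fun f ≗ fun g
    ; _∙_      = _⊙_
    ; ε        = idNDPF
    ; isMonoid = record
      { isSemigroup = record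
        { isMagma = record
          { isEquivalence = record
            { refl  = λ _ → refl
            ; sym   = λ p i → sym (p i)
            ; trans = λ p q i → trans (p i) (q i)
            }
          ; ∙-cong = λ {f} {f′} {g} {g′} p q i →
              trans (cong (fun f) (q i)) (p (fun g′ i))
          }
        ; assoc = λ _ _ _ _ → refl
        }
      ; identity = (λ _ _ → refl) , (λ _ _ → refl)
      }
    }

{-# OPTIONS --safe #-}
module Submission where

-- Words in the π_i act on ℤ in two ways: through the s_i as an affine
-- permutation x, and through the generators of NDPF as a parking function f.
-- As long as each letter lengthens the permutation, f k is the suffix minimum
-- min {x m | m ≥ k}. A [321]-avoiding x increases on the positions that are not
-- suffix minima, and it is an order isomorphism from these positions to the
-- missed values; the sum condition fixes the remaining shift, so x is determined
-- by f.
-- In the quotient every word reduces to one in which any two occurrences of i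
-- have both i - 1 and i + 1 between them, since π_i w π_i = π_i w when w contains
-- no i - 1, and π_i w π_i = w π_i when w contains no i + 1. In such a word every
-- value moves in one direction only. Hence the permutation avoids [321], its total
-- downward displacement equals the length of the word, which makes the word
-- reduced, and the word can be recovered up to commutations.

open import Defs
open import Algebra.Bundles using (Monoid)
open import Algebra.Morphism.Structures using (module MonoidMorphisms)
open import Data.Bool.Base using (if_then_else_)
open import Data.Empty using (⊥; ⊥-elim)
open import Data.Fin.Base using (Fin; toℕ)
open import Data.Fin.Properties using (_≟_; toℕ-injective; toℕ-fromℕ<; fromℕ<-cong; toℕ<n)
import Data.Integer.Base as Integer
open import Data.Integer.Base
  using (ℤ; +_; -[1+_]; 0ℤ; 1ℤ; _+_; _-_; -_; _*_; _⊔_; ∣_∣; +≤+; -≤+)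
open import Data.Integer.DivMod using (_%ℕ_; _/ℕ_; n%ℕd<d; a≡a%ℕn+[a/ℕn]*n)
import Data.Integer.Properties as ℤₚ
open import Data.Integer.Tactic.RingSolver using (solve-∀)
open import Data.List.Base using (List; []; _∷_; _++_; foldr; map; upTo; applyUpTo; length)
open import Data.List.Properties using (map-upTo; applyUpTo-∷ʳ; foldr-∷ʳ; ++-monoid)
open import Data.Nat.Base as ℕ using (ℕ; zero; suc; NonZero)
open import Data.Nat.Combinatorics using (_C_; nCk+nC[k+1]≡[n+1]C[k+1]; nC1≡n)
import Data.Nat.DivMod as ℕ
import Data.Nat.Properties as ℕₚ
open import Data.Product using (_×_; _,_; proj₁; proj₂; ∃; ∃₂; ∃!)
open import Data.Sum.Base using (_⊎_; inj₁; inj₂)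
open import Function.Base using (id; _∘_; case_of_)
open import Relation.Binary.Definitions using (Tri; tri<; tri≈; tri>)
open import Relation.Binary.PropositionalEquality
open import Relation.Nullary using (¬_; Dec; yes; no; does; contradiction)
open import Relation.Nullary.Decidable using (dec-true; dec-false; _×-dec_)

-- The order of ℤ is opened only locally, since _≤_ in the theorem is that of ℕ.
module _ where

  open Integer using (_≤_; _<_)

  i+j-j≡i : ∀ i j → i + j - j ≡ i
  i+j-j≡i = solve-∀

  i-j+j≡i : ∀ i j → i - j + j ≡ i
  i-j+j≡i = solve-∀

  i+j+k≡i+k+j : ∀ i j k → i + j + k ≡ i + k + j
  i+j+k≡i+k+j = solve-∀

  i+j+1≡i+[1+j] : ∀ i j → i + j + 1ℤ ≡ i + (1ℤ + j)
  i+j+1≡i+[1+j] = solve-∀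

  i+[j-i]≡j : ∀ i j → i + (j - i) ≡ j
  i+[j-i]≡j = solve-∀

  i+1-1≡i : ∀ i → i + 1ℤ - 1ℤ ≡ i
  i+1-1≡i i = i+j-j≡i i 1ℤ

  i-1+1≡i : ∀ i → i - 1ℤ + 1ℤ ≡ i
  i-1+1≡i i = i-j+j≡i i 1ℤ

  +-cancelʳ-≡ : ∀ k {i j} → i + k ≡ j + k → i ≡ j
  +-cancelʳ-≡ k {i} {j} p = trans (sym (i+j-j≡i i k)) (trans (cong (_- k) p) (i+j-j≡i j k))

  +-cancelʳ-< : ∀ k {i j} → i + k < j + k → i < j
  +-cancelʳ-< k {i} {j} lt = subst₂ _<_ (i+j-j≡i i k) (i+j-j≡i j k) (ℤₚ.+-monoˡ-< (- k) lt)

  i≤∣i∣ : ∀ i → i ≤ + ∣ i ∣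
  i≤∣i∣ (+ n)    = ℤₚ.≤-refl
  i≤∣i∣ -[1+ n ] = -≤+

  i≤j⇒j≡i+∣j-i∣ : ∀ {i j} → i ≤ j → j ≡ i + + ∣ j - i ∣
  i≤j⇒j≡i+∣j-i∣ {i} {j} i≤j =
    trans (sym (i+[j-i]≡j i j)) (cong (_+_ i) (sym (ℤₚ.0≤i⇒+∣i∣≡i (ℤₚ.i≤j⇒0≤j-i i≤j))))

  i<i+1 : ∀ i → i < i + 1ℤ
  i<i+1 i = subst (i <_) (ℤₚ.+-comm 1ℤ i) (ℤₚ.suc[i]≤j⇒i<j ℤₚ.≤-refl)

  i-1<i : ∀ i → i - 1ℤ < i
  i-1<i i = subst (i - 1ℤ <_) (i-1+1≡i i) (i<i+1 (i - 1ℤ))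

  i<j⇒i+1≤j : ∀ {i j} → i < j → i + 1ℤ ≤ j
  i<j⇒i+1≤j {i} {j} i<j = subst (_≤ j) (ℤₚ.+-comm 1ℤ i) (ℤₚ.i<j⇒suc[i]≤j i<j)

  i+1≤j⇒i<j : ∀ {i j} → i + 1ℤ ≤ j → i < j
  i+1≤j⇒i<j {i} = ℤₚ.<-≤-trans (i<i+1 i)

  i<j⇒i≤j-1 : ∀ {i j} → i < j → i ≤ j - 1ℤ
  i<j⇒i≤j-1 {i} {j} i<j =
    subst (_≤ j - 1ℤ) (i+1-1≡i i) (ℤₚ.+-monoˡ-≤ (- 1ℤ) (i<j⇒i+1≤j i<j))

  i<j+1⇒i≤j : ∀ {i j} → i < j + 1ℤ → i ≤ j
  i<j+1⇒i≤j {i} {j} i<j+1 = subst (i ≤_) (i+1-1≡i j) (i<j⇒i≤j-1 i<j+1)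

  -- Finite sums

  ∑ : ℕ → (ℕ → ℤ) → ℤ
  ∑ zero    f = 0ℤ
  ∑ (suc n) f = ∑ n f + f n

  ∑-mono-≤ : ∀ n {f g} → (∀ k → f k ≤ g k) → ∑ n f ≤ ∑ n g
  ∑-mono-≤ zero    f≤g = ℤₚ.≤-refl
  ∑-mono-≤ (suc n) f≤g = ℤₚ.+-mono-≤ (∑-mono-≤ n f≤g) (f≤g n)

  ∑-cong : ∀ n {f g} → (∀ k → f k ≡ g k) → ∑ n f ≡ ∑ n g
  ∑-cong zero    f≡g = refl
  ∑-cong (suc n) f≡g = cong₂ _+_ (∑-cong n f≡g) (f≡g n)

  ∑-mono-< : ∀ n {f g} → (∀ k → f k ≤ g k) → ∀ {m} → m ℕ.< n → f m < g m → ∑ n f < ∑ n g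
  ∑-mono-< (suc n) f≤g {m} m<1+n fm<gm with m ℕₚ.≟ n
  ... | yes refl = ℤₚ.+-mono-≤-< (∑-mono-≤ n f≤g) fm<gm
  ... | no m≢n   = ℤₚ.+-mono-<-≤ (∑-mono-< n f≤g (ℕₚ.≤∧≢⇒< (ℕₚ.≤-pred m<1+n) m≢n) fm<gm) (f≤g n)

  ∑-+ : ∀ n f g → ∑ n (λ k → f k + g k) ≡ ∑ n f + ∑ n g
  ∑-+ zero    f g = refl
  ∑-+ (suc n) f g = trans (cong (_+ (f n + g n)) (∑-+ n f g)) (e (∑ n f) (∑ n g) (f n) (g n))
    where
    e : ∀ a b c d → a + b + (c + d) ≡ a + c + (b + d)
    e = solve-∀

  ∑-zero : ∀ n {f} → (∀ k → k ℕ.< n → f k ≡ 0ℤ) → ∑ n f ≡ 0ℤ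
  ∑-zero zero    f≡0 = refl
  ∑-zero (suc n) f≡0 = cong₂ _+_ (∑-zero n λ k k<n → f≡0 k (ℕₚ.m<n⇒m<1+n k<n)) (f≡0 n ℕₚ.≤-refl)

  ∑-single : ∀ n {f m} → m ℕ.< n → f m ≡ 1ℤ → (∀ k → k ℕ.< n → k ≢ m → f k ≡ 0ℤ) → ∑ n f ≡ 1ℤ
  ∑-single (suc n) {f} {m} m<1+n fm≡1 f≡0 with m ℕₚ.≟ n
  ... | yes refl = cong₂ _+_ (∑-zero n λ k k<n → f≡0 k (ℕₚ.m<n⇒m<1+n k<n) (ℕₚ.<⇒≢ k<n)) fm≡1
  ... | no m≢n   = cong₂ _+_
    (∑-single n (ℕₚ.≤∧≢⇒< (ℕₚ.≤-pred m<1+n) m≢n) fm≡1 λ k k<n → f≡0 k (ℕₚ.m<n⇒m<1+n k<n))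
    (f≡0 n ℕₚ.≤-refl (m≢n ∘ sym))

module Presentation (N : ℕ) .{{_ : NonZero N}} (3≤N : 3 ℕ.≤ N) where

  open Integer using (_≤_; _<_)
  open NDPF using (fun; regressive; orderPreserving; notShift)
  open AffinePermutation using (bijective; skewPeriodic; sum≡) renaming (fun to perm)
  open Monoid (NDPF-monoid N) using (_∙_; ε)
  open Monoid (H₀/extra N) using () renaming (_≈_ to _~_; refl to ~-refl)

  r : ℤ → Fin N
  r = residue

  private
    no-carry : ∀ {a b} n → a ℕ.< N → + a ≡ + b + + suc n * + N → a ≡ b
    no-carry {a} {b} n a<N e = contradiction a<N (ℕₚ.≤⇒≯ (subst (N ℕ.≤_) (sym a≡)
      (ℕₚ.≤-trans (ℕₚ.m≤m+n N (n ℕ.* N)) (ℕₚ.m≤n+m _ b))))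
      where
      a≡ : a ≡ b ℕ.+ suc n ℕ.* N
      a≡ = ℤₚ.+-injective (trans e (trans (cong (_+_ (+ b)) (sym (ℤₚ.pos-* (suc n) N))) (sym (ℤₚ.pos-+ b _))))

  remainder-unique : ∀ {a b} t → a ℕ.< N → b ℕ.< N → + a ≡ + b + t * + N → a ≡ b
  remainder-unique {a} {b} (+ zero) a<N b<N e =
    ℤₚ.+-injective (trans e (trans (cong (_+_ (+ b)) (ℤₚ.*-zeroˡ (+ N))) (ℤₚ.+-identityʳ (+ b))))
  remainder-unique (+ suc n) a<N b<N e = no-carry n a<N e
  remainder-unique {a} {b} -[1+ n ] a<N b<N e =
    sym (no-carry n b<N (trans (e₁ (+ b) -[1+ n ] (+ N)) (cong (_+ (+ suc n * + N)) (sym e))))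
    where
    e₁ : ∀ b t n → b ≡ b + t * n + (- t) * n
    e₁ = solve-∀

  %-unique : ∀ {i b} t → b ℕ.< N → i ≡ + b + t * + N → i %ℕ N ≡ b
  %-unique {i} {b} t b<N i≡ = remainder-unique (t - i /ℕ N) (n%ℕd<d i N) b<N
    (trans (e₁ (+ (i %ℕ N)) (i /ℕ N) (+ N))
      (trans (cong (_- (i /ℕ N) * + N) (trans (sym (a≡a%ℕn+[a/ℕn]*n i N)) i≡))
        (e₂ (+ b) t (i /ℕ N) (+ N))))
    where
    e₁ : ∀ a q n → a ≡ a + q * n - q * n
    e₁ = solve-∀
    e₂ : ∀ b t q n → b + t * n - q * n ≡ b + (t - q) * n
    e₂ = solve-∀

  residue-+* : ∀ i n → r (i + n * + N) ≡ r i
  residue-+* i n = fromℕ<-cong _ _ (%-unique {i + n * + N} (i /ℕ N + n) (n%ℕd<d i N)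
    (trans (cong (_+ n * + N) (a≡a%ℕn+[a/ℕn]*n i N)) (e (+ (i %ℕ N)) (i /ℕ N) (+ N) n))) _ _
    where
    e : ∀ a q m n → a + q * m + n * m ≡ a + (q + n) * m
    e = solve-∀

  residue-fibre : ∀ {i j} → r i ≡ r j → ∃ λ n → j ≡ i + n * + N
  residue-fibre {i} {j} p = j /ℕ N - i /ℕ N ,
    trans (a≡a%ℕn+[a/ℕn]*n j N)
      (trans (cong (λ a → + a + j /ℕ N * + N) (sym q))
        (trans (e (+ (i %ℕ N)) (i /ℕ N) (j /ℕ N) (+ N))
          (cong (_+ (j /ℕ N - i /ℕ N) * + N) (sym (a≡a%ℕn+[a/ℕn]*n i N)))))
    where
    q : i %ℕ N ≡ j %ℕ N
    q = trans (sym (toℕ-fromℕ< _)) (trans (cong toℕ p) (toℕ-fromℕ< _))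
    e : ∀ a x y n → a + y * n ≡ a + x * n + (y - x) * n
    e = solve-∀

  residue-toℕ : ∀ i → r (+ toℕ i) ≡ i
  residue-toℕ i = toℕ-injective (trans (toℕ-fromℕ< _)
    (%-unique {+ toℕ i} {toℕ i} 0ℤ (toℕ<n i)
      (sym (trans (cong (_+_ (+ toℕ i)) (ℤₚ.*-zeroˡ (+ N))) (ℤₚ.+-identityʳ _)))))

  residue-next : ∀ i → r (i + 1ℤ) ≡ next (r i)
  residue-next i = toℕ-injective (trans (toℕ-fromℕ< _) (trans
    (%-unique {i + 1ℤ} {suc a ℕ.% N} (i /ℕ N + + (suc a ℕ./ N)) (ℕ.m%n<n (suc a) N)
      (trans (cong (_+ 1ℤ) (a≡a%ℕn+[a/ℕn]*n i N))
      (trans (e₁ (+ a) (i /ℕ N) (+ N))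
      (trans (cong (λ z → + z + i /ℕ N * + N) (ℕ.m≡m%n+[m/n]*n (suc a) N))
      (trans (cong (_+ i /ℕ N * + N) (ℤₚ.pos-+ (suc a ℕ.% N) _))
      (trans (cong (λ z → + (suc a ℕ.% N) + z + i /ℕ N * + N) (ℤₚ.pos-* (suc a ℕ./ N) N))
        (e₂ (+ (suc a ℕ.% N)) (+ (suc a ℕ./ N)) (+ N) (i /ℕ N))))))))
    (trans (cong (λ z → suc z ℕ.% N) (sym (toℕ-fromℕ< (n%ℕd<d i N)))) (sym (toℕ-fromℕ< _)))))
    where
    a = i %ℕ N
    e₁ : ∀ a q n → a + q * n + 1ℤ ≡ 1ℤ + a + q * n
    e₁ = solve-∀
    e₂ : ∀ b q n t → b + q * n + t * n ≡ b + (t + q) * n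
    e₂ = solve-∀

  residue-surjective : ∀ i → ∃ λ m → r m ≡ i
  residue-surjective i = + toℕ i , residue-toℕ i

  next-injective : ∀ {i j} → next i ≡ next j → i ≡ j
  next-injective {i} {j} p with residue-surjective i | residue-surjective j
  ... | a , refl | b , refl with residue-fibre {a + 1ℤ} {b + 1ℤ}
    (trans (residue-next a) (trans p (sym (residue-next b))))
  ... | n , q = sym (trans (cong r b≡) (residue-+* a n))
    where
    b≡ : b ≡ a + n * + N
    b≡ = +-cancelʳ-≡ 1ℤ (trans q (i+j+k≡i+k+j a 1ℤ (n * + N)))

  residue-+-≢ : ∀ i d → suc d ℕ.< N → r (i + + suc d) ≢ r i
  residue-+-≢ i d d<N p with residue-fibre {i + + suc d} {i} p
  ... | n , q = contradiction (remainder-unique {0} {suc d} n (ℕₚ.<-trans (ℕ.s≤s ℕ.z≤n) d<N) d<N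
      (trans (sym (ℤₚ.+-inverseʳ i)) (trans (cong (_- i) q) (e i (+ suc d) (n * + N))))) λ ()
    where
    e : ∀ i d x → i + d + x - i ≡ d + x
    e = solve-∀

  next-≢ : ∀ i → next i ≢ i
  next-≢ i p with residue-surjective i
  ... | m , refl = residue-+-≢ m 0 (ℕₚ.≤-trans (ℕ.s≤s (ℕ.s≤s ℕ.z≤n)) 3≤N) (trans (residue-next m) p)

  next²-≢ : ∀ i → next (next i) ≢ i
  next²-≢ i p with residue-surjective i
  ... | m , refl = residue-+-≢ m 1 3≤N (trans (cong r (e m))
      (trans (residue-next (m + 1ℤ)) (trans (cong next (residue-next m)) p)))
    where
    e : ∀ m → m + + 2 ≡ m + 1ℤ + 1ℤ
    e = solve-∀

  prev : Fin N → Fin N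
  prev i = r (+ toℕ i - 1ℤ)

  next-prev : ∀ i → next (prev i) ≡ i
  next-prev i = trans (sym (residue-next (+ toℕ i - 1ℤ)))
    (trans (cong r (i-1+1≡i (+ toℕ i))) (residue-toℕ i))

  residue-prev : ∀ m → r (m - 1ℤ) ≡ prev (r m)
  residue-prev m = next-injective (trans (sym (residue-next (m - 1ℤ)))
    (trans (cong r (i-1+1≡i m)) (sym (next-prev (r m)))))

  skewPeriodic-* : ∀ f → SkewPeriodic N f → ∀ n i → f (i + n * + N) ≡ f i + n * + N
  skewPeriodic-* f per (+ n) = nonneg n
    where
    e : ∀ i n m → i + (1ℤ + n) * m ≡ i + n * m + m
    e = solve-∀
    z : ∀ i m → i + 0ℤ * m ≡ i
    z = solve-∀
    nonneg : ∀ n i → f (i + + n * + N) ≡ f i + + n * + N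
    nonneg zero    i = trans (cong f (z i (+ N))) (sym (z (f i) (+ N)))
    nonneg (suc n) i = trans (cong f (e i (+ n) (+ N)))
      (trans (per _) (trans (cong (_+ + N) (nonneg n i)) (sym (e (f i) (+ n) (+ N)))))
  skewPeriodic-* f per -[1+ n ] i =
    trans (sym (e₁ (f i′) (+ suc n) (+ N)))
      (trans (cong (_- + suc n * + N) (sym (skewPeriodic-* f per (+ suc n) i′)))
        (trans (cong (λ z → f z - + suc n * + N) (e₂ i (+ suc n) (+ N))) (e₃ (f i) (+ suc n) (+ N))))
    where
    i′ = i + -[1+ n ] * + N
    e₁ : ∀ a b c → a + b * c - b * c ≡ a
    e₁ = solve-∀
    e₂ : ∀ a b c → a + (- b) * c + b * c ≡ a
    e₂ = solve-∀
    e₃ : ∀ a b c → a - b * c ≡ a + (- b) * c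
    e₃ = solve-∀

  residue-skewPeriodic : ∀ f → SkewPeriodic N f → ∀ i j → r i ≡ r j → ∀ {c} → r (f i) ≡ c → r (f j) ≡ c
  residue-skewPeriodic f per i j p q with residue-fibre {i} {j} p
  ... | n , refl = trans (cong r (skewPeriodic-* f per n i)) (trans (residue-+* (f i) n) q)

  residue-+N : ∀ i → r (i + + N) ≡ r i
  residue-+N i = trans (cong (λ z → r (i + z)) (sym (ℤₚ.*-identityˡ (+ N)))) (residue-+* i 1ℤ)

  data SimpleView (i : Fin N) (j : ℤ) : Set where
    up   : r j ≡ i → simple i j ≡ j + 1ℤ → SimpleView i j
    down : r j ≡ next i → simple i j ≡ j - 1ℤ → SimpleView i j
    stay : r j ≢ i → r j ≢ next i → simple i j ≡ j → SimpleView i j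

  simple-up : ∀ {i} j → r j ≡ i → simple i j ≡ j + 1ℤ
  simple-up {i} j p rewrite dec-true (r j ≟ i) p = refl

  simple-down : ∀ {i} j → r j ≡ next i → simple i j ≡ j - 1ℤ
  simple-down {i} j p
    rewrite dec-false (r j ≟ i) (λ q → next-≢ i (trans (sym p) q)) | dec-true (r j ≟ next i) p = refl

  simple-stay : ∀ {i} j → r j ≢ i → r j ≢ next i → simple i j ≡ j
  simple-stay {i} j p q
    rewrite dec-false (r j ≟ i) p | dec-false (r j ≟ next i) q = refl

  simpleView : ∀ i j → SimpleView i j
  simpleView i j with r j ≟ i
  ... | yes p = up p (simple-up j p)
  ... | no p with r j ≟ next i
  ...   | yes q = down q (simple-down j q)
  ...   | no q  = stay p q (simple-stay j p q)

  simple-involutive : ∀ i j → simple i (simple i j) ≡ j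
  simple-involutive i j with simpleView i j
  ... | up p e     = trans (cong (simple i) e)
    (trans (simple-down (j + 1ℤ) (trans (residue-next j) (cong next p))) (i+1-1≡i j))
  ... | down p e   = trans (cong (simple i) e)
    (trans (simple-up (j - 1ℤ) (next-injective (trans (sym (residue-next (j - 1ℤ)))
      (trans (cong r (i-1+1≡i j)) p)))) (i-1+1≡i j))
  ... | stay p q e = trans (cong (simple i) e) e

  simple-injective : ∀ i {j k} → simple i j ≡ simple i k → j ≡ k
  simple-injective i {j} {k} p =
    trans (sym (simple-involutive i j)) (trans (cong (simple i) p) (simple-involutive i k))

  simple-skewPeriodic : ∀ i → SkewPeriodic N (simple i)
  simple-skewPeriodic i j with simpleView i j
  ... | up p e     = trans (simple-up (j + + N) (trans (residue-+N j) p))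
    (trans (i+j+k≡i+k+j j (+ N) 1ℤ) (cong (_+ + N) (sym e)))
  ... | down p e   = trans (simple-down (j + + N) (trans (residue-+N j) p))
    (trans (i+j+k≡i+k+j j (+ N) (- 1ℤ)) (cong (_+ + N) (sym e)))
  ... | stay p q e = trans (simple-stay (j + + N) (p ∘ trans (sym (residue-+N j))) (q ∘ trans (sym (residue-+N j))))
    (cong (_+ + N) (sym e))

  simple≤+1 : ∀ i j → simple i j ≤ j + 1ℤ
  simple≤+1 i j with simpleView i j
  ... | up _ e     = ℤₚ.≤-reflexive e
  ... | down _ e   = subst (_≤ j + 1ℤ) (sym e) (ℤₚ.<⇒≤ (ℤₚ.<-trans (i-1<i j) (i<i+1 j)))
  ... | stay _ _ e = subst (_≤ j + 1ℤ) (sym e) (ℤₚ.<⇒≤ (i<i+1 j))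

  -1≤simple : ∀ i j → j - 1ℤ ≤ simple i j
  -1≤simple i j = subst (j - 1ℤ ≤_) (i+1-1≡i (simple i j))
    (ℤₚ.+-monoˡ-≤ (- 1ℤ) (subst (_≤ simple i j + 1ℤ) (simple-involutive i j) (simple≤+1 i (simple i j))))

  simple-mono-< : ∀ i {j k} → j < k → (r j ≡ i → k ≢ j + 1ℤ) → simple i j < simple i k
  simple-mono-< i {j} {k} j<k ≢+1 =
    ℤₚ.≤∧≢⇒< (ℤₚ.≤-trans below (-1≤simple i k)) (ℤₚ.<⇒≢ j<k ∘ simple-injective i)
    where
    below : simple i j ≤ k - 1ℤ
    below with simpleView i j
    ... | up p e     = subst (_≤ k - 1ℤ) (sym e)
      (i<j⇒i≤j-1 (ℤₚ.≤∧≢⇒< (i<j⇒i+1≤j j<k) (≢+1 p ∘ sym)))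
    ... | down p e   = subst (_≤ k - 1ℤ) (sym e) (ℤₚ.+-monoˡ-≤ (- 1ℤ) (ℤₚ.<⇒≤ j<k))
    ... | stay _ _ e = subst (_≤ k - 1ℤ) (sym e) (i<j⇒i≤j-1 j<k)

  -- Words as permutations

  unwind : List (Fin N) → ℤ → ℤ
  unwind []      = id
  unwind (i ∷ u) = unwind u ∘ simple i

  unwind-wordProduct : ∀ u k → unwind u (wordProduct u k) ≡ k
  unwind-wordProduct []      k = refl
  unwind-wordProduct (i ∷ u) k =
    trans (cong (unwind u) (simple-involutive i (wordProduct u k))) (unwind-wordProduct u k)

  wordProduct-unwind : ∀ u k → wordProduct u (unwind u k) ≡ k
  wordProduct-unwind []      k = refl
  wordProduct-unwind (i ∷ u) k =
    trans (cong (simple i) (wordProduct-unwind u (simple i k))) (simple-involutive i k)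

  wordProduct-injective : ∀ u {j k} → wordProduct u j ≡ wordProduct u k → j ≡ k
  wordProduct-injective u {j} {k} p =
    trans (sym (unwind-wordProduct u j)) (trans (cong (unwind u) p) (unwind-wordProduct u k))

  wordProduct-skewPeriodic : ∀ u → SkewPeriodic N (wordProduct u)
  wordProduct-skewPeriodic []      k = refl
  wordProduct-skewPeriodic (i ∷ u) k =
    trans (cong (simple i) (wordProduct-skewPeriodic u k)) (simple-skewPeriodic i (wordProduct u k))

  unwind-cong : ∀ u v → wordProduct u ≗ wordProduct v → unwind u ≗ unwind v
  unwind-cong u v u≗v k = wordProduct-injective u (trans (wordProduct-unwind u k)
    (sym (trans (u≗v (unwind v k)) (wordProduct-unwind v k))))

  ∑ₚ : (ℤ → ℤ) → ℤ
  ∑ₚ f = ∑ N (λ k → f (+ suc k))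

  foldr-upTo : ∀ f n → foldr _+_ 0ℤ (map f (upTo n)) ≡ ∑ n f
  foldr-upTo f n = trans (cong (foldr _+_ 0ℤ) (map-upTo f n)) (go n)
    where
    acc : ∀ z xs → foldr _+_ z xs ≡ foldr _+_ 0ℤ xs + z
    acc z []       = sym (ℤₚ.+-identityˡ z)
    acc z (x ∷ xs) = trans (cong (_+_ x) (acc z xs)) (sym (ℤₚ.+-assoc x _ z))
    go : ∀ n → foldr _+_ 0ℤ (applyUpTo f n) ≡ ∑ n f
    go zero    = refl
    go (suc n) = trans (cong (foldr _+_ 0ℤ) (sym (applyUpTo-∷ʳ f n)))
      (trans (foldr-∷ʳ _+_ 0ℤ (f n) (applyUpTo f n))
        (trans (acc (f n + 0ℤ) (applyUpTo f n))
          (cong₂ _+_ (go n) (ℤₚ.+-identityʳ (f n)))))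

  period-representative : ∀ p → ∃₂ λ k n → k ℕ.< N × p ≡ + suc k + n * + N
  period-representative p = k , (p - 1ℤ) /ℕ N , n%ℕd<d (p - 1ℤ) N ,
    trans (sym (i-1+1≡i p)) (trans (cong (_+ 1ℤ) (a≡a%ℕn+[a/ℕn]*n (p - 1ℤ) N))
      (e (+ k) ((p - 1ℤ) /ℕ N * + N)))
    where
    k = (p - 1ℤ) %ℕ N
    e : ∀ a b → a + b + 1ℤ ≡ 1ℤ + a + b
    e = solve-∀

  δ : Fin N → ℤ → ℤ
  δ c v = if does (r v ≟ c) then 1ℤ else 0ℤ

  ∑ₚ-δ : ∀ c x → SkewPeriodic N x → (∀ {j k} → x j ≡ x k → j ≡ k) → (∀ v → ∃ λ k → x k ≡ v) →
    ∑ₚ (δ c ∘ x) ≡ 1ℤ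
  ∑ₚ-δ c x per inj surj with residue-surjective c
  ... | m , rm≡c with surj m
  ... | p , xp≡m with period-representative p
  ... | k , n , k<N , p≡ = ∑-single N k<N (δ≡1 k rk) λ l l<N l≢k → δ≡0 l λ rl → l≢k (unique l l<N rl)
    where
    δ≡1 : ∀ k → r (x (+ suc k)) ≡ c → δ c (x (+ suc k)) ≡ 1ℤ
    δ≡1 k p rewrite dec-true (r (x (+ suc k)) ≟ c) p = refl
    δ≡0 : ∀ k → r (x (+ suc k)) ≢ c → δ c (x (+ suc k)) ≡ 0ℤ
    δ≡0 k p rewrite dec-false (r (x (+ suc k)) ≟ c) p = refl
    rk : r (x (+ suc k)) ≡ c
    rk = residue-skewPeriodic x per p (+ suc k)
      (trans (cong r p≡) (residue-+* (+ suc k) n)) (trans (cong r xp≡m) rm≡c)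
    unique : ∀ l → l ℕ.< N → r (x (+ suc l)) ≡ c → l ≡ k
    unique l l<N rl with residue-fibre {x (+ suc k)} {x (+ suc l)} (trans rk (sym rl))
    ... | t , q = remainder-unique t l<N k<N
      (trans (sym (e (+ l))) (trans (cong (_- 1ℤ) (inj (trans q (sym (skewPeriodic-* x per t (+ suc k))))))
        (e′ (+ k) (t * + N))))
      where
      e : ∀ l → 1ℤ + l - 1ℤ ≡ l
      e = solve-∀
      e′ : ∀ l a → 1ℤ + l + a - 1ℤ ≡ l + a
      e′ = solve-∀

  ∑ₚ-δ-wordProduct : ∀ c u → ∑ₚ (δ c ∘ wordProduct u) ≡ 1ℤ
  ∑ₚ-δ-wordProduct c u = ∑ₚ-δ c (wordProduct u) (wordProduct-skewPeriodic u)
    (wordProduct-injective u) (λ v → unwind u v , wordProduct-unwind u v)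

  simple-δ : ∀ i v → simple i v + δ (next i) v ≡ v + δ i v
  simple-δ i v with simpleView i v
  ... | up p e rewrite e | dec-true (r v ≟ i) p
          | dec-false (r v ≟ next i) (λ q → next-≢ i (trans (sym q) p)) = ℤₚ.+-identityʳ (v + 1ℤ)
  ... | down p e rewrite e | dec-true (r v ≟ next i) p
          | dec-false (r v ≟ i) (λ q → next-≢ i (trans (sym p) q)) = trans (i-1+1≡i v) (sym (ℤₚ.+-identityʳ v))
  ... | stay p q e rewrite e | dec-false (r v ≟ i) p | dec-false (r v ≟ next i) q = refl

  ∑ₚ-wordProduct : ∀ u → ∑ₚ (wordProduct u) ≡ ∑ₚ id
  ∑ₚ-wordProduct []      = refl
  ∑ₚ-wordProduct (i ∷ u) = trans (+-cancelʳ-≡ 1ℤ (begin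
    ∑ₚ (simple i ∘ x) + 1ℤ                    ≡⟨ cong (_+_ (∑ₚ (simple i ∘ x))) (∑ₚ-δ-wordProduct (next i) u) ⟨
    ∑ₚ (simple i ∘ x) + ∑ₚ (δ (next i) ∘ x)   ≡⟨ ∑-+ N _ _ ⟨
    ∑ₚ (λ k → simple i (x k) + δ (next i) (x k)) ≡⟨ ∑-cong N (λ k → simple-δ i (x (+ suc k))) ⟩
    ∑ₚ (λ k → x k + δ i (x k))                ≡⟨ ∑-+ N _ _ ⟩
    ∑ₚ x + ∑ₚ (δ i ∘ x)                       ≡⟨ cong (_+_ (∑ₚ x)) (∑ₚ-δ-wordProduct i u) ⟩
    ∑ₚ x + 1ℤ                                 ∎)) (∑ₚ-wordProduct u)
    where
    open ≡-Reasoning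
    x = wordProduct u

  ∑ₚ-id : ∑ₚ id ≡ + (suc N C 2)
  ∑ₚ-id = go N
    where
    go : ∀ n → ∑ n (λ k → + suc k) ≡ + (suc n C 2)
    go zero    = refl
    go (suc n) = trans (cong (_+ + suc n) (go n)) (trans (sym (ℤₚ.pos-+ (suc n C 2) (suc n)))
      (cong +_ (trans (ℕₚ.+-comm (suc n C 2) (suc n))
        (trans (cong (ℕ._+ suc n C 2) (sym (nC1≡n (suc n)))) (nCk+nC[k+1]≡[n+1]C[k+1] (suc n) 1)))))

  wordPermutation : List (Fin N) → AffinePermutation N
  wordPermutation u = record
    { fun          = wordProduct u
    ; bijective    = wordProduct-injective u ,
                     λ v → unwind u v , λ { refl → wordProduct-unwind u v }
    ; skewPeriodic = wordProduct-skewPeriodic u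
    ; sum≡         = trans (foldr-upTo (λ k → wordProduct u (+ suc k)) N) (trans (∑ₚ-wordProduct u) ∑ₚ-id)
    }

  -- Displacement bounds the length from below

  _⁺ : ℤ → ℤ
  z ⁺ = z ⊔ 0ℤ

  totalDrop : (ℤ → ℤ) → ℤ
  totalDrop x = ∑ₚ (λ k → (k - x k) ⁺)

  totalDrop≤length : ∀ u → totalDrop (wordProduct u) ≤ + length u
  totalDrop≤length []      = ℤₚ.≤-reflexive (∑-zero N λ k _ → cong (_⊔ 0ℤ) (ℤₚ.+-inverseʳ (+ suc k)))
  totalDrop≤length (i ∷ u) = begin
    totalDrop (simple i ∘ x)                                   ≤⟨ ∑-mono-≤ N (λ k → step (+ suc k) (x (+ suc k))) ⟩
    ∑ₚ (λ k → (k - x k) ⁺ + δ (next i) (x k))             ≡⟨ ∑-+ N _ _ ⟩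
    totalDrop x + ∑ₚ (δ (next i) ∘ x)                          ≡⟨ cong (_+_ (totalDrop x)) (∑ₚ-δ-wordProduct (next i) u) ⟩
    totalDrop x + 1ℤ                                           ≤⟨ ℤₚ.+-monoˡ-≤ 1ℤ (totalDrop≤length u) ⟩
    + length u + 1ℤ                                       ≡⟨ ℤₚ.+-comm (+ length u) 1ℤ ⟩
    + length (i ∷ u)                                      ∎
    where
    open ℤₚ.≤-Reasoning
    x = wordProduct u
    c : ∀ k v → k - (v - 1ℤ) ≡ k - v + 1ℤ
    c = solve-∀
    step : ∀ k v → (k - simple i v) ⁺ ≤ (k - v) ⁺ + δ (next i) v
    step k v with simpleView i v
    ... | up p e rewrite e | dec-false (r v ≟ next i) (λ q → next-≢ i (trans (sym q) p)) =
      subst (((k - (v + 1ℤ)) ⁺) ≤_) (sym (ℤₚ.+-identityʳ _))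
        (ℤₚ.⊔-monoˡ-≤ 0ℤ (ℤₚ.+-monoʳ-≤ k (ℤₚ.neg-mono-≤ (ℤₚ.<⇒≤ (i<i+1 v)))))
    ... | down p e rewrite e | dec-true (r v ≟ next i) p =
      ℤₚ.⊔-lub (subst (_≤ (k - v) ⁺ + 1ℤ) (sym (c k v)) (ℤₚ.+-monoˡ-≤ 1ℤ (ℤₚ.i≤i⊔j (k - v) 0ℤ)))
        (ℤₚ.≤-trans (ℤₚ.i≤j⊔i (k - v) 0ℤ) (ℤₚ.<⇒≤ (i<i+1 _)))
    ... | stay p q e rewrite e | dec-false (r v ≟ next i) q = ℤₚ.≤-reflexive (sym (ℤₚ.+-identityʳ _))

  lower : Fin N → ℤ → ℤ
  lower i j = if does (r j ≟ next i) then j - 1ℤ else j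

  lower-down : ∀ {i} j → r j ≡ next i → lower i j ≡ j - 1ℤ
  lower-down {i} j p rewrite dec-true (r j ≟ next i) p = refl

  lower-stay : ∀ {i} j → r j ≢ next i → lower i j ≡ j
  lower-stay {i} j p rewrite dec-false (r j ≟ next i) p = refl

  lower≤ : ∀ i j → lower i j ≤ j
  lower≤ i j with r j ≟ next i
  ... | yes p = ℤₚ.<⇒≤ (i-1<i j)
  ... | no p  = ℤₚ.≤-refl

  lower-mono-≤ : ∀ i {j k} → j ≤ k → lower i j ≤ lower i k
  lower-mono-≤ i {j} {k} j≤k with j ℤₚ.≟ k
  ... | yes refl = ℤₚ.≤-refl
  ... | no j≢k with r k ≟ next i
  ...   | yes p = ℤₚ.≤-trans (lower≤ i j) (i<j⇒i≤j-1 (ℤₚ.≤∧≢⇒< j≤k j≢k))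
  ...   | no p  = ℤₚ.≤-trans (lower≤ i j) j≤k

  lower-skewPeriodic : ∀ i → SkewPeriodic N (lower i)
  lower-skewPeriodic i j with r j ≟ next i
  ... | yes p = trans (lower-down (j + + N) (trans (residue-+N j) p)) (i+j+k≡i+k+j j (+ N) (- 1ℤ))
  ... | no p  = lower-stay (j + + N) (p ∘ trans (sym (residue-+N j)))

  notShift-fixed : ∀ {f m} → f m ≡ m → ∀ t → t ≢ 0ℤ → ¬ IsShift t f
  notShift-fixed {f} {m} fm≡m t t≢0 sh =
    t≢0 (trans (e m t) (trans (cong (λ z → m - z) (trans (sym (sh m)) fm≡m)) (ℤₚ.+-inverseʳ m)))
    where
    e : ∀ m t → t ≡ m - (m - t)
    e = solve-∀

  generator : Fin N → NDPF N
  generator i = record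
    { fun             = lower i
    ; regressive      = lower≤ i
    ; orderPreserving = lower-mono-≤ i
    ; skewPeriodic    = lower-skewPeriodic i
    ; notShift        = notShift-fixed {m = + toℕ i}
        (lower-stay (+ toℕ i) λ p → next-≢ i (trans (sym p) (residue-toℕ i)))
    }

  evaluate : List (Fin N) → NDPF N
  evaluate = foldr (λ i f → generator i ∙ f) ε

  -- Suffix minima

  SuffixMinimum : (ℤ → ℤ) → (ℤ → ℤ) → Set
  SuffixMinimum x f = (∀ {k m} → k ≤ m → f k ≤ x m) × (∀ k → ∃ λ m → k ≤ m × f k ≡ x m)

  Ascent : Fin N → (ℤ → ℤ) → Set
  Ascent i x = ∀ {a b} → r (x a) ≡ i → x b ≡ x a + 1ℤ → a < b

  suffixMinimum-simple : ∀ i {x f} → (∀ v → ∃ λ k → x k ≡ v) → Ascent i x →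
    SuffixMinimum x f → SuffixMinimum (simple i ∘ x) (lower i ∘ f)
  suffixMinimum-simple i {x} {f} surj asc (lb , att) = lb′ , att′
    where
    lb′ : ∀ {k m} → k ≤ m → lower i (f k) ≤ simple i (x m)
    lb′ {k} {m} k≤m with simpleView i (x m)
    ... | up _ e     = subst (lower i (f k) ≤_) (sym e)
      (ℤₚ.≤-trans (lower≤ i (f k)) (ℤₚ.≤-trans (lb k≤m) (ℤₚ.<⇒≤ (i<i+1 (x m)))))
    ... | stay _ _ e = subst (lower i (f k) ≤_) (sym e) (ℤₚ.≤-trans (lower≤ i (f k)) (lb k≤m))
    ... | down p e with f k ℤₚ.≟ x m
    ...   | yes q = ℤₚ.≤-reflexive (trans (cong (lower i) q) (trans (lower-down (x m) p) (sym e)))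
    ...   | no q  = subst (lower i (f k) ≤_) (sym e)
      (ℤₚ.≤-trans (lower≤ i (f k)) (i<j⇒i≤j-1 (ℤₚ.≤∧≢⇒< (lb k≤m) q)))
    att′ : ∀ k → ∃ λ m → k ≤ m × lower i (f k) ≡ simple i (x m)
    att′ k with att k
    ... | m , k≤m , q with simpleView i (x m)
    ...   | down p e   = m , k≤m , trans (cong (lower i) q) (trans (lower-down (x m) p) (sym e))
    ...   | stay _ p e = m , k≤m , trans (cong (lower i) q) (trans (lower-stay (x m) p) (sym e))
    ...   | up p e with surj (x m + 1ℤ)
    ...     | m′ , q′ = m′ , ℤₚ.≤-trans k≤m (ℤₚ.<⇒≤ (asc p q′)) ,
      trans (cong (lower i) q) (trans (lower-stay (x m) λ p′ → next-≢ i (trans (sym p′) p))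
        (trans (sym (i+1-1≡i (x m))) (trans (cong (_- 1ℤ) (sym q′)) (sym (simple-down (x m′)
          (trans (cong r q′) (trans (residue-next (x m)) (cong next p))))))))

  -- Normal words

  data Before (a b : Fin N) : List (Fin N) → Set where
    []    : Before a b []
    here  : ∀ {u} → Before a b (a ∷ u)
    there : ∀ {c u} → c ≢ b → Before a b u → Before a b (c ∷ u)

  before-total : ∀ {a b} → a ≢ b → ∀ u → Before a b u ⊎ Before b a u
  before-total a≢b [] = inj₁ []
  before-total {a} {b} a≢b (c ∷ u) with c ≟ a | c ≟ b
  ... | yes refl | _        = inj₁ here
  ... | no _     | yes refl = inj₂ here
  ... | no c≢a   | no c≢b with before-total a≢b u
  ...   | inj₁ p = inj₁ (there c≢b p)
  ...   | inj₂ p = inj₂ (there c≢a p)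

  -- Since u itself is normal, the condition at i makes both neighbours of i occur
  -- between any two consecutive occurrences of i.
  data Normal : List (Fin N) → Set where
    []  : Normal []
    _∷_ : ∀ {i u} → Before (prev i) i u × Before (next i) i u → Normal u → Normal (i ∷ u)

  prev-next : ∀ i → prev (next i) ≡ i
  prev-next i = next-injective (next-prev (next i))

  prev-≢ : ∀ i → prev i ≢ i
  prev-≢ i p = next-≢ i (trans (cong next (sym p)) (next-prev i))

  -- The first letter of u that moves v, if any, moves it down (Falls) or up (Rises).
  Falls Rises : List (Fin N) → ℤ → Set
  Falls u v = Before (prev (r v)) (r v) u
  Rises u v = Before (r v) (prev (r v)) u

  falls-or-rises : ∀ u v → Falls u v ⊎ Rises u v
  falls-or-rises u v = before-total (prev-≢ (r v)) u

  falls-∷ : ∀ {c u} v → Normal (c ∷ u) → Falls (c ∷ u) v →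
    r v ≢ c × simple c v ≤ v × Falls u (simple c v)
  falls-∷ {c} {u} v ((p , _) ∷ _) fl with c ≟ prev (r v)
  ... | yes c≡ = (λ q → prev-≢ (r v) (trans (sym c≡) (sym q))) ,
    subst (_≤ v) (sym e) (ℤₚ.<⇒≤ (i-1<i v)) ,
    subst (λ a → Before (prev a) a u) (trans c≡ (trans (sym (residue-prev v)) (cong r (sym e)))) p
    where
    e : simple c v ≡ v - 1ℤ
    e = simple-down v (trans (sym (next-prev (r v))) (cong next (sym c≡)))
  ... | no c≢ with fl
  ...   | here = ⊥-elim (c≢ refl)
  ...   | there c≢rv fl′ = c≢rv ∘ sym , ℤₚ.≤-reflexive e , subst (Falls u) (sym e) fl′
    where
    e : simple c v ≡ v
    e = simple-stay v (c≢rv ∘ sym) λ q → c≢ (trans (sym (prev-next c)) (cong prev (sym q)))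

  rises-∷ : ∀ {c u} v → Normal (c ∷ u) → Rises (c ∷ u) v →
    c ≢ prev (r v) × v ≤ simple c v × Rises u (simple c v)
  rises-∷ {c} {u} v ((_ , p) ∷ _) rs with c ≟ r v
  ... | yes c≡ = (λ q → prev-≢ (r v) (trans (sym q) c≡)) ,
    subst (v ≤_) (sym e) (ℤₚ.<⇒≤ (i<i+1 v)) ,
    subst (λ a → Before a (prev a) u) (trans (cong next c≡) (trans (sym (residue-next v)) (cong r (sym e))))
      (subst (λ a → Before (next c) a u) (sym (prev-next c)) p)
    where
    e : simple c v ≡ v + 1ℤ
    e = simple-up v (sym c≡)
  ... | no c≢ with rs
  ...   | here = ⊥-elim (c≢ refl)
  ...   | there c≢pv rs′ = c≢pv , ℤₚ.≤-reflexive (sym e) , subst (Rises u) (sym e) rs′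
    where
    e : simple c v ≡ v
    e = simple-stay v (c≢ ∘ sym) λ q → c≢pv (trans (sym (prev-next c)) (cong prev (sym q)))

  unwind-falls : ∀ {u} → Normal u → ∀ v → Falls u v → unwind u v ≤ v
  unwind-falls [] v _ = ℤₚ.≤-refl
  unwind-falls n@(_ ∷ n′) v fl with falls-∷ v n fl
  ... | _ , ≤v , fl′ = ℤₚ.≤-trans (unwind-falls n′ _ fl′) ≤v

  unwind-rises : ∀ {u} → Normal u → ∀ v → Rises u v → v ≤ unwind u v
  unwind-rises [] v _ = ℤₚ.≤-refl
  unwind-rises n@(_ ∷ n′) v rs with rises-∷ v n rs
  ... | _ , v≤ , rs′ = ℤₚ.≤-trans v≤ (unwind-rises n′ _ rs′)

  unwind-falls-mono-< : ∀ {u} → Normal u → ∀ {v w} → Falls u v → Falls u w → v < w → unwind u v < unwind u w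
  unwind-falls-mono-< [] _ _ v<w = v<w
  unwind-falls-mono-< {c ∷ _} n@(_ ∷ n′) {v} {w} fv fw v<w with falls-∷ v n fv | falls-∷ w n fw
  ... | rv≢c , _ , fv′ | _ , _ , fw′ =
    unwind-falls-mono-< n′ fv′ fw′ (simple-mono-< c v<w (⊥-elim ∘ rv≢c))

  unwind-rises-mono-< : ∀ {u} → Normal u → ∀ {v w} → Rises u v → Rises u w → v < w → unwind u v < unwind u w
  unwind-rises-mono-< [] _ _ v<w = v<w
  unwind-rises-mono-< {c ∷ _} n@(_ ∷ n′) {v} {w} rv rw v<w with rises-∷ v n rv | rises-∷ w n rw
  ... | _ , _ , rv′ | c≢ , _ , rw′ = unwind-rises-mono-< n′ rv′ rw′
    (simple-mono-< c v<w λ p q → c≢ (trans (sym p) (trans (sym (prev-next (r v)))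
      (cong prev (trans (sym (residue-next v)) (cong r (sym q)))))))

  Avoids : (ℤ → ℤ) → Set
  Avoids x = ∀ {a b d} → a < b → b < d → x d < x b → ¬ x b < x a

  falls-increasing : ∀ {u} → Normal u → ∀ {p q} → p < q → let x = wordProduct u in
    Falls u (x p) → Falls u (x q) → ¬ x q < x p
  falls-increasing {u} n {p} {q} p<q fp fq q↓p = ℤₚ.<-asym p<q
    (subst₂ _<_ (unwind-wordProduct u q) (unwind-wordProduct u p) (unwind-falls-mono-< n fq fp q↓p))

  rises-increasing : ∀ {u} → Normal u → ∀ {p q} → p < q → let x = wordProduct u in
    Rises u (x p) → Rises u (x q) → ¬ x q < x p
  rises-increasing {u} n {p} {q} p<q rp rq q↓p = ℤₚ.<-asym p<q
    (subst₂ _<_ (unwind-wordProduct u q) (unwind-wordProduct u p) (unwind-rises-mono-< n rq rp q↓p))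

  -- Of three positions, two carry values moving in the same direction.
  normal-avoids : ∀ {u} → Normal u → Avoids (wordProduct u)
  normal-avoids {u} n {a} {b} {d} a<b b<d d↓b b↓a = pigeonhole
    (falls-or-rises u (wordProduct u a)) (falls-or-rises u (wordProduct u b)) (falls-or-rises u (wordProduct u d))
    where
    x = wordProduct u
    pigeonhole : Falls u (x a) ⊎ Rises u (x a) → Falls u (x b) ⊎ Rises u (x b) → Falls u (x d) ⊎ Rises u (x d) → ⊥
    pigeonhole (inj₁ fa) (inj₁ fb) _         = falls-increasing n a<b fa fb b↓a
    pigeonhole (inj₁ fa) (inj₂ _)  (inj₁ fd) = falls-increasing n (ℤₚ.<-trans a<b b<d) fa fd (ℤₚ.<-trans d↓b b↓a)
    pigeonhole (inj₁ _)  (inj₂ rb) (inj₂ rd) = rises-increasing n b<d rb rd d↓b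
    pigeonhole (inj₂ _)  (inj₁ fb) (inj₁ fd) = falls-increasing n b<d fb fd d↓b
    pigeonhole (inj₂ ra) (inj₁ _)  (inj₂ rd) = rises-increasing n (ℤₚ.<-trans a<b b<d) ra rd (ℤₚ.<-trans d↓b b↓a)
    pigeonhole (inj₂ ra) (inj₂ rb) _         = rises-increasing n a<b ra rb b↓a

  normal-falls : ∀ {i u} v → Normal (i ∷ u) → r v ≡ i → unwind u v ≤ v
  normal-falls v ((p , _) ∷ n) refl = unwind-falls n v p

  normal-rises : ∀ {i u} v → Normal (i ∷ u) → r v ≡ next i → v ≤ unwind u v
  normal-rises {i} {u} v ((_ , p) ∷ n) e = unwind-rises n v
    (subst₂ (λ a b → Before a b u) (sym e) (sym (trans (cong prev e) (prev-next i))) p)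

  normal-ascent : ∀ {i u} → Normal (i ∷ u) → Ascent i (wordProduct u)
  normal-ascent {i} {u} n {a} {b} p q = begin-strict
    a                        ≡⟨ unwind-wordProduct u a ⟨
    unwind u (x a)           ≤⟨ normal-falls (x a) n p ⟩
    x a                      <⟨ i<i+1 (x a) ⟩
    x a + 1ℤ                 ≡⟨ q ⟨
    x b                      ≤⟨ normal-rises (x b) n (trans (cong r q) (trans (residue-next (x a)) (cong next p))) ⟩
    unwind u (x b)           ≡⟨ unwind-wordProduct u b ⟩
    b                        ∎
    where
    open ℤₚ.≤-Reasoning
    x = wordProduct u

  suffixMinimum-id : SuffixMinimum id id
  suffixMinimum-id = id , λ k → k , ℤₚ.≤-refl , refl

  wordProduct-surjective : ∀ u v → ∃ λ k → wordProduct u k ≡ v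
  wordProduct-surjective u v = unwind u v , wordProduct-unwind u v

  normal-suffixMinimum : ∀ {u} → Normal u → SuffixMinimum (wordProduct u) (fun (evaluate u))
  normal-suffixMinimum [] = suffixMinimum-id
  normal-suffixMinimum {i ∷ u} n@(_ ∷ n′) =
    suffixMinimum-simple i (wordProduct-surjective u) (λ {a} {b} → normal-ascent n {a} {b}) (normal-suffixMinimum n′)

  length≤totalDrop : ∀ {u} → Normal u → + length u ≤ totalDrop (wordProduct u)
  length≤totalDrop [] = ℤₚ.≤-reflexive (sym (∑-zero N λ k _ → cong (_⊔ 0ℤ) (ℤₚ.+-inverseʳ (+ suc k))))
  length≤totalDrop {i ∷ u} n@(_ ∷ n′) = begin
    + length (i ∷ u)                                      ≡⟨ ℤₚ.+-comm 1ℤ (+ length u) ⟩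
    + length u + 1ℤ                                       ≤⟨ ℤₚ.+-monoˡ-≤ 1ℤ (length≤totalDrop n′) ⟩
    totalDrop x + 1ℤ                                           ≡⟨ cong (_+_ (totalDrop x)) (∑ₚ-δ-wordProduct (next i) u) ⟨
    totalDrop x + ∑ₚ (δ (next i) ∘ x)                          ≡⟨ ∑-+ N _ _ ⟨
    ∑ₚ (λ k → (k - x k) ⁺ + δ (next i) (x k))             ≤⟨ ∑-mono-≤ N (λ k →
                                                               step (+ suc k) (x (+ suc k)) (unwind-wordProduct u (+ suc k))) ⟩
    totalDrop (simple i ∘ x)                                   ∎
    where
    open ℤₚ.≤-Reasoning
    x = wordProduct u
    c : ∀ k v → k - v + 1ℤ ≡ k - (v - 1ℤ)
    c = solve-∀
    step : ∀ k v → unwind u v ≡ k → (k - v) ⁺ + δ (next i) v ≤ (k - simple i v) ⁺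
    step k v q with simpleView i v
    ... | up p e rewrite e | dec-false (r v ≟ next i) (λ q → next-≢ i (trans (sym q) p)) =
      subst (_≤ (k - (v + 1ℤ)) ⁺)
        (sym (trans (ℤₚ.+-identityʳ _) (ℤₚ.i≤j⇒i⊔j≡j (ℤₚ.i≤j⇒i-j≤0 (subst (_≤ v) q (normal-falls v n p))))))
        (ℤₚ.i≤j⊔i (k - (v + 1ℤ)) 0ℤ)
    ... | down p e rewrite e | dec-true (r v ≟ next i) p =
      subst (_≤ (k - (v - 1ℤ)) ⁺)
        (sym (trans (cong (_+ 1ℤ) (ℤₚ.i≥j⇒i⊔j≡i (ℤₚ.i≤j⇒0≤j-i (subst (v ≤_) q (normal-rises v n p))))) (c k v)))
        (ℤₚ.i≤i⊔j (k - (v - 1ℤ)) 0ℤ)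
    ... | stay p p′ e rewrite e | dec-false (r v ≟ next i) p′ = ℤₚ.≤-reflexive (ℤₚ.+-identityʳ _)

  normal-shortest : ∀ {u} → Normal u → ∀ v → wordProduct v ≗ wordProduct u → length u ℕ.≤ length v
  normal-shortest {u} n v v≗u = ℤₚ.drop‿+≤+ (begin
    + length u           ≤⟨ length≤totalDrop n ⟩
    totalDrop (wordProduct u) ≡⟨ ∑-cong N (λ k → cong (λ z → (+ suc k - z) ⁺) (v≗u (+ suc k))) ⟨
    totalDrop (wordProduct v) ≤⟨ totalDrop≤length v ⟩
    + length v           ∎)
    where open ℤₚ.≤-Reasoning

  ~-∷ : ∀ i {u v} → u ~ v → i ∷ u ~ i ∷ v
  ~-∷ i u~v = ~-cong {x = i ∷ []} {y = i ∷ []} ~-refl u~v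

  hecke : ∀ {x y} → HeckeRelation N x y → ∀ w → x ++ w ~ y ++ w
  hecke h w = ~-cong (base (gen h)) ~-refl

  ~-idempotent : ∀ i w → i ∷ i ∷ w ~ i ∷ w
  ~-idempotent i = hecke (idempotent i)

  Distant : Fin N → Fin N → Set
  Distant i j = j ≢ i × j ≢ next i × i ≢ next j

  ~-commute : ∀ {i j} → Distant i j → ∀ w → i ∷ j ∷ w ~ j ∷ i ∷ w
  ~-commute {i} {j} (_ , p , q) = hecke (commute i j p q)

  ~-collapseʳ : ∀ i w → i ∷ next i ∷ i ∷ w ~ i ∷ next i ∷ w
  ~-collapseʳ i w = ~-cong (gen (extra i)) ~-refl

  ~-collapseˡ : ∀ {i p} → next p ≡ i → ∀ w → i ∷ p ∷ i ∷ w ~ p ∷ i ∷ w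
  ~-collapseˡ {p = p} refl w = ~-trans (~-sym (hecke (braid p) w)) (~-collapseʳ p w)

  -- Reduction to normal words

  data Reaches (a b : Fin N) : List (Fin N) → Set where
    here  : ∀ {u} → Reaches a b (a ∷ u)
    there : ∀ {c u} → c ≢ a → c ≢ b → Reaches a b u → Reaches a b (c ∷ u)

  before-or-reaches : ∀ {a b} → a ≢ b → ∀ u → Before b a u ⊎ Reaches a b u
  before-or-reaches a≢b [] = inj₁ []
  before-or-reaches {a} {b} a≢b (c ∷ u) with c ≟ a | c ≟ b
  ... | yes refl | _        = inj₂ here
  ... | no _     | yes refl = inj₁ here
  ... | no c≢a   | no c≢b with before-or-reaches a≢b u
  ...   | inj₁ p = inj₁ (there c≢a p)
  ...   | inj₂ p = inj₂ (there c≢a c≢b p)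

  absorb : ∀ {i u} → Reaches i (next i) u → i ∷ u ~ u
  absorb {i} here = ~-idempotent i _
  absorb {i} (there {c} {u} c≢i c≢next rc) with i ≟ next c
  ... | yes i≡ = ~-trans (~-∷ i (~-∷ c (~-sym (absorb rc))))
    (~-trans (~-collapseˡ (sym i≡) u) (~-∷ c (absorb rc)))
  ... | no i≢  = ~-trans (~-commute (c≢i , c≢next , i≢) u) (~-∷ c (absorb rc))

  cancel : ∀ {i u} → Reaches i (prev i) u → ∃ λ u′ → i ∷ u ~ i ∷ u′ × suc (length u′) ≡ length u
  cancel {i} (here {u}) = u , ~-idempotent i u , refl
  cancel {i} (there {c} {u} c≢i c≢prev rc) with cancel rc
  ... | u′ , p , q with c ≟ next i
  ...   | yes refl = c ∷ u′ , ~-trans (~-sym (~-collapseʳ i u))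
    (~-trans (~-∷ i (~-∷ c p)) (~-collapseʳ i u′)) , cong suc q
  ...   | no c≢next = c ∷ u′ , ~-trans (~-commute dist u) (~-trans (~-∷ c p) (~-sym (~-commute dist u′))) , cong suc q
    where
    dist : Distant i c
    dist = c≢i , c≢next , λ e → c≢prev (trans (sym (prev-next c)) (cong prev (sym e)))

  normalize : ∀ n u → length u ℕ.≤ n → ∃ λ t → Normal t × t ~ u × length t ℕ.≤ length u
  normalize n       []      _         = [] , [] , ~-refl , ℕ.z≤n
  normalize (suc n) (i ∷ u) (ℕ.s≤s l) with normalize n u l
  ... | t , nt , t~u , t≤u with before-or-reaches (prev-≢ i ∘ sym) t | before-or-reaches (next-≢ i ∘ sym) t
  ...   | _      | inj₂ q = t , nt , ~-trans (~-sym (absorb q)) (~-∷ i t~u) , ℕₚ.m≤n⇒m≤1+n t≤u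
  ...   | inj₁ p | inj₁ q = i ∷ t , (p , q) ∷ nt , ~-∷ i t~u , ℕ.s≤s t≤u
  ...   | inj₂ p | inj₁ _ with cancel p
  ...     | t′ , e , l′ with normalize n (i ∷ t′) (ℕₚ.≤-trans (ℕₚ.≤-reflexive l′) (ℕₚ.≤-trans t≤u l))
  ...       | s , ns , s~ , s≤ = s , ns , ~-trans s~ (~-trans (~-sym e) (~-∷ i t~u)) ,
    ℕₚ.≤-trans s≤ (ℕₚ.≤-trans (ℕₚ.≤-reflexive l′) (ℕₚ.m≤n⇒m≤1+n t≤u))

  -- Normal words of the same permutation

  data Pull (i : Fin N) : List (Fin N) → List (Fin N) → Set where
    here  : ∀ {v} → Pull i (i ∷ v) v
    there : ∀ {c v v′} → Distant c i → Pull i v v′ → Pull i (c ∷ v) (c ∷ v′)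

  pull : ∀ {i v} → Reaches i (prev i) v → Reaches i (next i) v → ∃ λ v′ → Pull i v v′
  pull here _ = _ , here
  pull (there c≢ _ _) here = ⊥-elim (c≢ refl)
  pull {i} (there {c} c≢i c≢prev p) (there _ c≢next q) with pull p q
  ... | v′ , pl = c ∷ v′ , there (c≢i ∘ sym ,
    (λ e → c≢prev (trans (sym (prev-next c)) (cong prev (sym e)))) , c≢next) pl

  pull-~ : ∀ {i v v′} → Pull i v v′ → v ~ i ∷ v′
  pull-~ here = ~-refl
  pull-~ (there {c} {v} {v′} d p) = ~-trans (~-∷ c (pull-~ p)) (~-commute d v′)

  pull-before : ∀ {i v v′ a b} → Pull i v v′ → i ≢ a → Before a b v → Before a b v′
  pull-before here      i≢a here        = ⊥-elim (i≢a refl)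
  pull-before here      i≢a (there _ p) = p
  pull-before (there _ p) i≢a here        = here
  pull-before (there _ p) i≢a (there q b) = there q (pull-before p i≢a b)

  pull-normal : ∀ {i v v′} → Pull i v v′ → Normal v → Normal v′
  pull-normal here (_ ∷ n) = n
  pull-normal (there {c} (_ , i≢next , c≢next) p) ((bp , bn) ∷ n) =
    (pull-before p (λ e → c≢next (trans (sym (next-prev c)) (cong next (sym e)))) bp ,
     pull-before p i≢next bn) ∷ pull-normal p n

  simple-distant : ∀ {i c} → Distant c i → ∀ k → r k ≡ i ⊎ r k ≡ next i → simple c k ≡ k
  simple-distant (i≢c , i≢nc , c≢ni) k (inj₁ refl) = simple-stay k i≢c i≢nc
  simple-distant (i≢c , i≢nc , c≢ni) k (inj₂ p)    =
    simple-stay k (λ q → c≢ni (trans (sym q) p)) λ q → i≢c (next-injective (trans (sym p) q))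

  simple-residue : ∀ i k → r k ≡ i ⊎ r k ≡ next i → r (simple i k) ≡ i ⊎ r (simple i k) ≡ next i
  simple-residue i k _ with simpleView i k
  ... | up p e   = inj₂ (trans (cong r e) (trans (residue-next k) (cong next p)))
  ... | down p e = inj₁ (trans (cong r e) (trans (residue-prev k) (trans (cong prev p) (prev-next i))))
  simple-residue i k (inj₁ p) | stay p′ _ _ = ⊥-elim (p′ p)
  simple-residue i k (inj₂ p) | stay _ p′ _ = ⊥-elim (p′ p)

  distant-sym : ∀ {i j} → Distant i j → Distant j i
  distant-sym (p , q , q′) = p ∘ sym , q′ , q

  simple-commute-moved : ∀ {c i} → Distant c i → ∀ k → r k ≡ i ⊎ r k ≡ next i →
    simple c (simple i k) ≡ simple i (simple c k)
  simple-commute-moved {i = i} d k p = trans (simple-distant d (simple i k) (simple-residue i k p))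
    (cong (simple i) (sym (simple-distant d k p)))

  simple-commute : ∀ {c i} → Distant c i → ∀ k → simple c (simple i k) ≡ simple i (simple c k)
  simple-commute {c} {i} d k with simpleView i k | simpleView c k
  ... | up p _     | _          = simple-commute-moved d k (inj₁ p)
  ... | down p _   | _          = simple-commute-moved d k (inj₂ p)
  ... | stay _ _ _ | up p _     = sym (simple-commute-moved (distant-sym d) k (inj₁ p))
  ... | stay _ _ _ | down p _   = sym (simple-commute-moved (distant-sym d) k (inj₂ p))
  ... | stay _ _ e | stay _ _ f = trans (cong (simple c) e) (trans f (sym (trans (cong (simple i) f) e)))

  pull-wordProduct : ∀ {i v v′} → Pull i v v′ → wordProduct v ≗ simple i ∘ wordProduct v′
  pull-wordProduct here k = refl
  pull-wordProduct (there {c} {v} {v′} d p) k =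
    trans (cong (simple c) (pull-wordProduct p k)) (simple-commute d (wordProduct v′ k))

  normal-unique : ∀ u v → Normal u → Normal v → wordProduct u ≗ wordProduct v → u ~ v
  normal-unique [] [] _ _ _ = ~-refl
  normal-unique [] (c ∷ v) _ n e with residue-surjective c
  ... | m , p = ⊥-elim (ℤₚ.<⇒≱ (i<i+1 m) (begin
    m + 1ℤ                     ≡⟨ unwind-cong [] (c ∷ v) e (m + 1ℤ) ⟩
    unwind v (simple c (m + 1ℤ)) ≡⟨ cong (unwind v) (trans
                                      (simple-down (m + 1ℤ) (trans (residue-next m) (cong next p))) (i+1-1≡i m)) ⟩
    unwind v m                 ≤⟨ normal-falls m n p ⟩
    m                          ∎))
    where open ℤₚ.≤-Reasoning
  normal-unique (i ∷ u) v n@(_ ∷ n′) nv e with residue-surjective i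
  ... | m , refl with before-or-reaches (prev-≢ (r m) ∘ sym) v | before-or-reaches (next-≢ (r m) ∘ sym) v
  ...   | inj₁ p | _ = ⊥-elim (ℤₚ.<⇒≱ (i<i+1 m) (begin
    m + 1ℤ                   ≤⟨ normal-rises (m + 1ℤ) n (residue-next m) ⟩
    unwind u (m + 1ℤ)        ≡⟨ cong (unwind u) (simple-up m refl) ⟨
    unwind (r m ∷ u) m       ≡⟨ unwind-cong (r m ∷ u) v e m ⟩
    unwind v m               ≤⟨ unwind-falls nv m p ⟩
    m                        ∎))
    where open ℤₚ.≤-Reasoning
  ...   | inj₂ _ | inj₁ p = ⊥-elim (ℤₚ.<⇒≱ (i<i+1 m) (begin
    m + 1ℤ                   ≤⟨ unwind-rises nv (m + 1ℤ) (subst₂ (λ a b → Before a b v) (sym (residue-next m))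
                                  (sym (trans (cong prev (residue-next m)) (prev-next (r m)))) p) ⟩
    unwind v (m + 1ℤ)        ≡⟨ unwind-cong (r m ∷ u) v e (m + 1ℤ) ⟨
    unwind (r m ∷ u) (m + 1ℤ) ≡⟨ cong (unwind u) (trans (simple-down (m + 1ℤ) (residue-next m)) (i+1-1≡i m)) ⟩
    unwind u m               ≤⟨ normal-falls m n refl ⟩
    m                        ∎))
    where open ℤₚ.≤-Reasoning
  ...   | inj₂ p | inj₂ q with pull p q
  ...     | v′ , pl = ~-trans (~-∷ (r m) (normal-unique u v′ n′ (pull-normal pl nv)
    (λ k → simple-injective (r m) (trans (e k) (pull-wordProduct pl k))))) (~-sym (pull-~ pl))

  -- The exchange property

  simple-inverts : ∀ c {a b} → a < b → simple c b < simple c a → r a ≡ c × b ≡ a + 1ℤ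
  simple-inverts c {a} {b} a<b gt = case ((r a ≟ c) , (b ℤₚ.≟ a + 1ℤ)) of λ where
    (no ra≢c , _)     → ⊥-elim (ℤₚ.<-asym gt (simple-mono-< c a<b (⊥-elim ∘ ra≢c)))
    (yes _   , no b≢) → ⊥-elim (ℤₚ.<-asym gt (simple-mono-< c a<b λ _ → b≢))
    (yes p   , yes q) → p , q

  -- v is the product of the letters already passed. It takes a < b to m and m + 1,
  -- whose positions are inverted, so some letter of w swaps them; that letter is dropped.
  exchange : ∀ v → SkewPeriodic N v → (∀ {j k} → v j ≡ v k → j ≡ k) → ∀ m w {a b} →
    v a ≡ m → v b ≡ m + 1ℤ → a < b → unwind w b < unwind w a →
    ∃ λ w′ → suc (length w′) ≡ length w × (∀ k → v (wordProduct w′ k) ≡ simple (r m) (v (wordProduct w k)))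
  exchange v per inj m [] va vb a<b b<a = ⊥-elim (ℤₚ.<-asym a<b b<a)
  exchange v per inj m (c ∷ w) {a} {b} va vb a<b b<a with ℤₚ.<-cmp (simple c a) (simple c b)
  ... | tri< lt _ _ = let w′ , l , e = exchange (v ∘ simple c)
                            (λ k → trans (cong v (simple-skewPeriodic c k)) (per (simple c k)))
                            (simple-injective c ∘ inj) m w
                            (trans (cong v (simple-involutive c a)) va)
                            (trans (cong v (simple-involutive c b)) vb) lt b<a
                      in c ∷ w′ , cong suc l , e
  ... | tri≈ _ eq _ = ⊥-elim (ℤₚ.<⇒≢ a<b (simple-injective c eq))
  ... | tri> _ _ gt with simple-inverts c a<b gt
  ...   | refl , refl = w , refl , λ k → sym (trans (cong (simple (r m)) (conj (wordProduct w k)))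
                          (simple-involutive (r m) (v (wordProduct w k))))
    where
    conj : ∀ k → v (simple (r a) k) ≡ simple (r m) (v k)
    conj k with simpleView (r a) k
    ... | up p e with residue-fibre {a} {k} (sym p)
    ...   | n , refl = trans (cong v e) (trans (cong v (i+j+k≡i+k+j a (n * + N) 1ℤ))
      (trans (skewPeriodic-* v per n (a + 1ℤ)) (trans (cong (_+ n * + N) vb)
      (trans (i+j+k≡i+k+j m 1ℤ (n * + N)) (sym (trans (cong (simple (r m)) vk)
        (simple-up (m + n * + N) (residue-+* m n))))))))
      where
      vk : v (a + n * + N) ≡ m + n * + N
      vk = trans (skewPeriodic-* v per n a) (cong (_+ n * + N) va)
    conj k | down p e with residue-fibre {a + 1ℤ} {k} (trans (residue-next a) (sym p))
    ...   | n , refl = trans (cong v e) (trans (cong v (c₁ a (n * + N))) (trans (skewPeriodic-* v per n a)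
      (trans (cong (_+ n * + N) va) (trans (c₂ m (n * + N)) (sym (trans (cong (simple (r m)) vk)
        (simple-down (m + 1ℤ + n * + N) (trans (residue-+* (m + 1ℤ) n) (residue-next m)))))))))
      where
      c₁ : ∀ a x → a + 1ℤ + x - 1ℤ ≡ a + x
      c₁ = solve-∀
      c₂ : ∀ a x → a + x ≡ a + 1ℤ + x - 1ℤ
      c₂ = solve-∀
      vk : v (a + 1ℤ + n * + N) ≡ m + 1ℤ + n * + N
      vk = trans (skewPeriodic-* v per n (a + 1ℤ)) (cong (_+ n * + N) vb)
    conj k | stay p q e = trans (cong v e) (sym (simple-stay (v k) p′ q′))
      where
      p′ : r (v k) ≢ r m
      p′ s with residue-fibre {m} {v k} (sym s)
      ... | n , t = p (trans
        (cong r (inj (trans t (trans (cong (_+ n * + N) (sym va)) (sym (skewPeriodic-* v per n a))))))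
        (residue-+* a n))
      q′ : r (v k) ≢ next (r m)
      q′ s with residue-fibre {m + 1ℤ} {v k} (trans (residue-next m) (sym s))
      ... | n , t = q (trans
        (cong r (inj (trans t (trans (cong (_+ n * + N) (sym vb)) (sym (skewPeriodic-* v per n (a + 1ℤ)))))))
        (trans (residue-+* (a + 1ℤ) n) (residue-next a)))

  Shortest : List (Fin N) → Set
  Shortest u = ∀ v → wordProduct v ≗ wordProduct u → length u ℕ.≤ length v

  shortest-tail : ∀ {i u} → Shortest (i ∷ u) → Shortest u
  shortest-tail {i} {u} sh v e = ℕₚ.≤-pred (sh (i ∷ v) λ k → cong (simple i) (e k))

  shortest-ascent : ∀ {i u} → Shortest (i ∷ u) → Ascent i (wordProduct u)
  shortest-ascent {i} {u} sh {a} {b} refl q with ℤₚ.<-cmp a b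
  ... | tri< a<b _ _ = a<b
  ... | tri≈ _ refl _ = ⊥-elim (ℤₚ.<⇒≢ (i<i+1 (wordProduct u a)) q)
  ... | tri> _ _ b<a = ⊥-elim (ℕₚ.<⇒≱ (ℕₚ.≤-reflexive l) (ℕₚ.≤-trans (ℕₚ.n≤1+n _) (sh w′ e)))
    where
    ex = exchange id (λ _ → refl) id (wordProduct u a) u refl refl (i<i+1 (wordProduct u a))
      (subst₂ _<_ (sym (trans (cong (unwind u) (sym q)) (unwind-wordProduct u b))) (sym (unwind-wordProduct u a)) b<a)
    w′ = proj₁ ex
    l = proj₁ (proj₂ ex)
    e = proj₂ (proj₂ ex)

  shortest-suffixMinimum : ∀ u → Shortest u → SuffixMinimum (wordProduct u) (fun (evaluate u))
  shortest-suffixMinimum []      _  = suffixMinimum-id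
  shortest-suffixMinimum (i ∷ u) sh = suffixMinimum-simple i (wordProduct-surjective u)
    (λ {a} {b} → shortest-ascent {u = u} sh {a} {b}) (shortest-suffixMinimum u (shortest-tail {i} {u} sh))

  -- Evaluation respects the congruence

  residue-pred : ∀ {i} k → r k ≡ next i → r (k - 1ℤ) ≡ i
  residue-pred k p = trans (residue-prev k) (trans (cong prev p) (prev-next _))

  lower-idempotent : ∀ i k → lower i (lower i k) ≡ lower i k
  lower-idempotent i k with r k ≟ next i
  ... | yes p = lower-stay (k - 1ℤ) λ q → next-≢ i (trans (sym q) (residue-pred k p))
  ... | no p  = lower-stay k p

  lower-commute : ∀ {i j} → j ≢ next i → i ≢ next j → ∀ k → lower i (lower j k) ≡ lower j (lower i k)
  lower-commute {i} {j} j≢ i≢ k = case ((r k ≟ next i) , (r k ≟ next j)) of λ where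
      (yes p , yes q) → let i≡j = next-injective (trans (sym p) q) in
                          trans (cong (λ c → lower c (lower j k)) i≡j) (cong (λ c → lower j (lower c k)) (sym i≡j))
      (yes p , no q)  → half i≢ p q
      (no p , yes q)  → sym (half j≢ q p)
      (no p , no q)   → trans (cong (lower i) (lower-stay k q)) (trans (lower-stay k p)
                          (sym (trans (cong (lower j) (lower-stay k p)) (lower-stay k q))))
    where
    half : ∀ {i j} → i ≢ next j → r k ≡ next i → r k ≢ next j → lower i (lower j k) ≡ lower j (lower i k)
    half {i} {j} i≢ p q = trans (cong (lower i) (lower-stay k q)) (trans (lower-down k p)
      (sym (trans (cong (lower j) (lower-down k p)) (lower-stay (k - 1ℤ) λ s → i≢ (trans (sym (residue-pred k p)) s)))))

  lower-collapseʳ : ∀ i k → lower i (lower (next i) (lower i k)) ≡ lower i (lower (next i) k)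
  lower-collapseʳ i k = case (r k ≟ next i) of λ where
      (no p)  → cong (lower i ∘ lower (next i)) (lower-stay k p)
      (yes p) → let q = residue-pred k p in
        trans (cong (lower i ∘ lower (next i)) (lower-down k p))
        (trans (cong (lower i) (lower-stay (k - 1ℤ) λ s → next²-≢ i (trans (sym s) q)))
        (trans (lower-stay (k - 1ℤ) λ s → next-≢ i (trans (sym s) q))
          (sym (trans (cong (lower i) (lower-stay k λ s → next-≢ (next i) (trans (sym s) p))) (lower-down k p)))))

  lower-collapseˡ : ∀ i k → lower (next i) (lower i (lower (next i) k)) ≡ lower i (lower (next i) k)
  lower-collapseˡ i k = lower-stay (lower i (lower (next i) k)) (avoids (r k ≟ next i) (r k ≟ next (next i)))
    where
    avoids : Dec (r k ≡ next i) → Dec (r k ≡ next (next i)) → r (lower i (lower (next i) k)) ≢ next (next i)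
    avoids _ (yes q) s = next²-≢ i (trans (sym s) (trans
      (cong r (trans (cong (lower i) (lower-down k q)) (lower-down (k - 1ℤ) (residue-pred k q))))
      (residue-pred (k - 1ℤ) (residue-pred k q))))
    avoids (yes p) (no q) s = next²-≢ i (trans (sym s) (trans
      (cong r (trans (cong (lower i) (lower-stay k q)) (lower-down k p))) (residue-pred k p)))
    avoids (no p) (no q) s = q (trans
      (cong r (sym (trans (cong (lower i) (lower-stay k q)) (lower-stay k p)))) s)

  evaluate-++ : ∀ u v k → fun (evaluate (u ++ v)) k ≡ fun (evaluate u) (fun (evaluate v) k)
  evaluate-++ []      v k = refl
  evaluate-++ (i ∷ u) v k = cong (lower i) (evaluate-++ u v k)

  evaluate-++-cong : ∀ x y {u v} → fun (evaluate x) ≗ fun (evaluate y) → fun (evaluate u) ≗ fun (evaluate v) →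
    fun (evaluate (x ++ u)) ≗ fun (evaluate (y ++ v))
  evaluate-++-cong x y {u} {v} p q k = trans (evaluate-++ x u k)
    (trans (cong (fun (evaluate x)) (q k)) (trans (p (fun (evaluate v) k)) (sym (evaluate-++ y v k))))

  evaluate-hecke : ∀ {u v} → Congruence (++-monoid (Fin N)) (HeckeRelation N) u v → fun (evaluate u) ≗ fun (evaluate v)
  evaluate-hecke (base refl) k = refl
  evaluate-hecke (gen (idempotent i)) k = lower-idempotent i k
  evaluate-hecke (gen (commute i j p q)) k = lower-commute p q k
  evaluate-hecke (gen (braid i)) k = trans (lower-collapseʳ i k) (sym (lower-collapseˡ i k))
  evaluate-hecke (~-sym p) k = sym (evaluate-hecke p k)
  evaluate-hecke (~-trans p q) k = trans (evaluate-hecke p k) (evaluate-hecke q k)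
  evaluate-hecke (~-cong {x} {y} p q) k = evaluate-++-cong x y (evaluate-hecke p) (evaluate-hecke q) k

  evaluate-cong : ∀ {u v} → u ~ v → fun (evaluate u) ≗ fun (evaluate v)
  evaluate-cong (base p) k = evaluate-hecke p k
  evaluate-cong (gen (extra i)) k = lower-collapseʳ i k
  evaluate-cong (~-sym p) k = sym (evaluate-cong p k)
  evaluate-cong (~-trans p q) k = trans (evaluate-cong p k) (evaluate-cong q k)
  evaluate-cong (~-cong {x} {y} p q) k = evaluate-++-cong x y (evaluate-cong p) (evaluate-cong q) k

  -- A [321]-avoiding permutation is determined by its suffix minima

  i≤j+∣i-j∣*N : ∀ i j → i ≤ j + + ∣ i - j ∣ * + N
  i≤j+∣i-j∣*N i j = subst (_≤ j + + ∣ i - j ∣ * + N) (i+[j-i]≡j j i)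
    (ℤₚ.+-monoʳ-≤ j (ℤₚ.≤-trans (i≤∣i∣ (i - j)) (subst (+ ∣ i - j ∣ ≤_) (ℤₚ.pos-* ∣ i - j ∣ N)
      (+≤+ (ℕₚ.m≤m*n ∣ i - j ∣ N)))))

  minimum-unique : ∀ {x y f} → (∀ {j k} → x j ≡ x k → j ≡ k) → SuffixMinimum x f → SuffixMinimum y f →
    ∀ k → x k ≡ f k → y k ≡ f k
  minimum-unique {x} {y} {f} inj (lbx , attx) (lby , atty) k xk≡fk with atty k
  ... | m , k≤m , fk≡ym with k ℤₚ.≟ m
  ...   | yes refl = sym fk≡ym
  ...   | no k≢m with attx (k + 1ℤ)
  ...     | l , k<l , f≡xl = ⊥-elim (ℤₚ.<⇒≢ (i+1≤j⇒i<j k<l) (inj (ℤₚ.≤-antisym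
    (subst (_≤ x l) (sym xk≡fk) (lbx (ℤₚ.<⇒≤ (i+1≤j⇒i<j k<l))))
    (subst₂ _≤_ f≡xl (trans (sym fk≡ym) (sym xk≡fk)) (lby (i<j⇒i+1≤j (ℤₚ.≤∧≢⇒< k≤m k≢m)))))))

  nonminimum-increasing : ∀ {x f} → (∀ {j k} → x j ≡ x k → j ≡ k) → Avoids x → SuffixMinimum x f →
    ∀ {a b} → x b ≢ f b → a < b → x a < x b
  nonminimum-increasing {x} {f} inj av (lb , att) {a} {b} xb≢fb a<b with ℤₚ.<-cmp (x a) (x b)
  ... | tri< lt _ _ = lt
  ... | tri≈ _ eq _ = ⊥-elim (ℤₚ.<⇒≢ a<b (inj eq))
  ... | tri> _ _ gt with att b
  ...   | m , b≤m , fb≡xm = ⊥-elim (av a<b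
    (ℤₚ.≤∧≢⇒< b≤m λ { refl → xb≢fb (sym fb≡xm) })
    (subst (_< x b) fb≡xm (ℤₚ.≤∧≢⇒< (lb ℤₚ.≤-refl) (xb≢fb ∘ sym))) gt)

  affine-injective : ∀ (x : AffinePermutation N) {j k} → perm x j ≡ perm x k → j ≡ k
  affine-injective x = proj₁ (bijective x)

  ∑ₚ-affine : ∀ (x : AffinePermutation N) → ∑ₚ (perm x) ≡ + (suc N C 2)
  ∑ₚ-affine x = trans (sym (foldr-upTo (λ k → perm x (+ suc k)) N)) (sum≡ x)

  module Rigidity {f} (per-f : SkewPeriodic N f) (x′ y′ : AffinePermutation N)
    (avx : Avoids (perm x′)) (avy : Avoids (perm y′))
    (smx : SuffixMinimum (perm x′) f) (smy : SuffixMinimum (perm y′) f) where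

    private
      x y : ℤ → ℤ
      x = perm x′
      y = perm y′

      x-increasing : ∀ {a b} → x b ≢ f b → a < b → x a < x b
      x-increasing = nonminimum-increasing (affine-injective x′) avx smx

      y-increasing : ∀ {a b} → x b ≢ f b → a < b → y a < y b
      y-increasing {a} {b} xb≢fb = nonminimum-increasing (affine-injective y′) avy smy
        λ yb≡fb → xb≢fb (minimum-unique {y} {x} (affine-injective y′) smy smx b yb≡fb)

      same-minimum : ∀ k → x k ≡ f k → y k ≡ f k
      same-minimum = minimum-unique {x} {y} (affine-injective x′) smx smy

      Straddles : ℤ → ℤ → Set
      Straddles m u = x u ≢ f u × x u ≤ m × m < y u

      climb : ∀ m → ∃ (Straddles m) → ∃ (Straddles (m + 1ℤ))
      climb m (u , xu≢fu , xu≤m , m<yu) with y u ℤₚ.≟ m + 1ℤ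
      ... | no yu≢   = u , xu≢fu , ℤₚ.≤-trans xu≤m (ℤₚ.<⇒≤ (i<i+1 m)) , ℤₚ.≤∧≢⇒< (i<j⇒i+1≤j m<yu) (yu≢ ∘ sym)
      ... | yes yu≡ with proj₂ (bijective x′) (y u)
      ...   | q , x-q = q , xq≢fq , ℤₚ.≤-reflexive xq≡ , subst (_< y q) yu≡ (y-increasing xq≢fq u<q)
        where
        xq≡yu : x q ≡ y u
        xq≡yu = x-q refl
        xq≡ : x q ≡ m + 1ℤ
        xq≡ = trans xq≡yu yu≡
        xu<xq : x u < x q
        xu<xq = subst (x u <_) (sym xq≡) (ℤₚ.≤-<-trans xu≤m (i<i+1 m))
        q≢u : q ≢ u
        q≢u refl = ℤₚ.<-irrefl refl xu<xq
        xq≢fq : x q ≢ f q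
        xq≢fq p = q≢u (affine-injective y′ (trans (same-minimum q p) (trans (sym p) xq≡yu)))
        u<q : u < q
        u<q with ℤₚ.<-cmp u q
        ... | tri< lt _ _ = lt
        ... | tri≈ _ eq _ = ⊥-elim (q≢u (sym eq))
        ... | tri> _ _ gt = ⊥-elim (ℤₚ.<-asym xu<xq (x-increasing xu≢fu gt))

    -- If y exceeds x anywhere, it does so at every position that is not a suffix
    -- minimum, so the sums over a period differ.
    no-excess : ∀ p → ¬ x p < y p
    no-excess p xp<yp with period-representative p
    ... | k , n , k<N , p≡ = ℤₚ.<⇒≢ (∑-mono-< N (λ l → everywhere (+ suc l)) k<N strict)
      (trans (∑ₚ-affine x′) (sym (∑ₚ-affine y′)))
      where
      ladder : ∀ n → ∃ (Straddles (x p + + n))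
      ladder zero    = p , (λ xp≡fp → ℤₚ.<⇒≢ xp<yp (trans xp≡fp (sym (same-minimum p xp≡fp)))) ,
        ℤₚ.≤-reflexive (sym (ℤₚ.+-identityʳ (x p))) , subst (_< y p) (sym (ℤₚ.+-identityʳ (x p))) xp<yp
      ladder (suc n) = subst (∃ ∘ Straddles) (i+j+1≡i+[1+j] (x p) (+ n)) (climb _ (ladder n))
      above : ∀ w → x w ≢ f w → x p ≤ x w → x w < y w
      above w xw≢fw xp≤xw with subst (∃ ∘ Straddles) (sym (i≤j⇒j≡i+∣j-i∣ xp≤xw)) (ladder ∣ x w - x p ∣)
      ... | u , xu≢fu , xu≤xw , xw<yu with ℤₚ.<-cmp u w
      ...   | tri< lt _ _ = ℤₚ.<-trans xw<yu (y-increasing xw≢fw lt)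
      ...   | tri≈ _ refl _ = xw<yu
      ...   | tri> _ _ gt = ⊥-elim (ℤₚ.<⇒≱ (x-increasing xu≢fu gt) xu≤xw)
      everywhere : ∀ w → x w ≤ y w
      everywhere w with x w ℤₚ.≟ f w
      ... | yes p = ℤₚ.≤-reflexive (trans p (sym (same-minimum w p)))
      ... | no xw≢fw = ℤₚ.<⇒≤ (+-cancelʳ-< K (subst₂ _<_ xw′ (skewPeriodic-* y (skewPeriodic y′) M w)
        (above (w + K) (λ q → xw≢fw (+-cancelʳ-≡ K (trans (sym xw′) (trans q (skewPeriodic-* f per-f M w)))))
          (subst (x p ≤_) (sym xw′) (i≤j+∣i-j∣*N (x p) (x w))))))
        where
        M = + ∣ x p - x w ∣
        K = M * + N
        xw′ : x (w + K) ≡ x w + K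
        xw′ = skewPeriodic-* x (skewPeriodic x′) M w
      strict : x (+ suc k) < y (+ suc k)
      strict = +-cancelʳ-< (n * + N) (subst₂ _<_
        (trans (cong x p≡) (skewPeriodic-* x (skewPeriodic x′) n (+ suc k)))
        (trans (cong y p≡) (skewPeriodic-* y (skewPeriodic y′) n (+ suc k))) xp<yp)

  avoiding-unique : ∀ {f} → SkewPeriodic N f → ∀ x y → Avoids (perm x) → Avoids (perm y) →
    SuffixMinimum (perm x) f → SuffixMinimum (perm y) f → x ≈ₐ y
  avoiding-unique per x y avx avy smx smy k with ℤₚ.<-cmp (perm x k) (perm y k)
  ... | tri< lt _ _ = ⊥-elim (Rigidity.no-excess per x y (λ {a} → avx {a}) (λ {a} → avy {a}) smx smy k lt)
  ... | tri≈ _ eq _ = eq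
  ... | tri> _ _ gt = ⊥-elim (Rigidity.no-excess per y x (λ {a} → avy {a}) (λ {a} → avx {a}) smy smx k gt)

  -- Every parking function is a product of generators

  excess : (ℤ → ℤ) → ℤ
  excess f = ∑ₚ (λ k → k - f k)

  -- Since f skips the class of f b + 1, it factors as lower i ∘ g, where g moves
  -- the fibre of f over the class i up by one wherever regressivity permits.
  module Factor (f : NDPF N) (b : ℤ) (jump : fun f b + 1ℤ < fun f (b + 1ℤ)) where

    i : Fin N
    i = r (fun f b)

    Raised : ℤ → Set
    Raised k = r (fun f k) ≡ i × fun f k < k

    raised? : ∀ k → Dec (Raised k)
    raised? k = (r (fun f k) ≟ i) ×-dec (fun f k ℤₚ.<? k)

    g : ℤ → ℤ
    g k = if does (raised? k) then fun f k + 1ℤ else fun f k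

    g-raised : ∀ k → Raised k → g k ≡ fun f k + 1ℤ
    g-raised k p rewrite dec-true (raised? k) p = refl

    g-kept : ∀ k → ¬ Raised k → g k ≡ fun f k
    g-kept k p rewrite dec-false (raised? k) p = refl

    f≤g : ∀ k → fun f k ≤ g k
    f≤g k with raised? k
    ... | yes p = ℤₚ.≤-trans (ℤₚ.<⇒≤ (i<i+1 (fun f k))) (ℤₚ.≤-reflexive (sym (g-raised k p)))
    ... | no p  = ℤₚ.≤-reflexive (sym (g-kept k p))

    b-raised : Raised b
    b-raised = refl , +-cancelʳ-< 1ℤ (ℤₚ.<-≤-trans jump (regressive f (b + 1ℤ)))

    f-skewPeriodic : ∀ n k → fun f (k + n * + N) ≡ fun f k + n * + N
    f-skewPeriodic = skewPeriodic-* (fun f) (NDPF.skewPeriodic f)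

    missing : ∀ k → r (fun f k) ≢ next i
    missing k p with residue-fibre {fun f b + 1ℤ} {fun f k} (trans (residue-next (fun f b)) (sym p))
    ... | n , q = absurd (ℤₚ.<-cmp (k - n * + N) (b + 1ℤ))
      where
      fk′ : fun f (k - n * + N) ≡ fun f b + 1ℤ
      fk′ = +-cancelʳ-≡ (n * + N)
        (trans (sym (f-skewPeriodic n (k - n * + N))) (trans (cong (fun f) (i-j+j≡i k (n * + N))) q))
      beyond : ¬ b + 1ℤ ≤ k - n * + N
      beyond le = ℤₚ.<⇒≱ jump (subst (fun f (b + 1ℤ) ≤_) fk′ (orderPreserving f le))
      absurd : Tri (k - n * + N < b + 1ℤ) (k - n * + N ≡ b + 1ℤ) (b + 1ℤ < k - n * + N) → ⊥
      absurd (tri< lt _ _) = ℤₚ.<⇒≱ (i<i+1 (fun f b)) (subst (_≤ fun f b) fk′ (orderPreserving f (i<j+1⇒i≤j lt)))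
      absurd (tri≈ _ eq _) = beyond (ℤₚ.≤-reflexive (sym eq))
      absurd (tri> _ _ gt) = beyond (ℤₚ.<⇒≤ gt)

    lower-g : ∀ k → lower i (g k) ≡ fun f k
    lower-g k with raised? k
    ... | yes p = trans (cong (lower i) (g-raised k p)) (trans
      (lower-down (fun f k + 1ℤ) (trans (residue-next (fun f k)) (cong next (proj₁ p)))) (i+1-1≡i (fun f k)))
    ... | no p  = trans (cong (lower i) (g-kept k p)) (lower-stay (fun f k) (missing k))

    g-regressive : ∀ k → g k ≤ k
    g-regressive k with raised? k
    ... | yes p = subst (_≤ k) (sym (g-raised k p)) (i<j⇒i+1≤j (proj₂ p))
    ... | no p  = subst (_≤ k) (sym (g-kept k p)) (regressive f k)

    g-mono : ∀ {k l} → k ≤ l → g k ≤ g l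
    g-mono {k} {l} k≤l with raised? k
    ... | no p  = subst (_≤ g l) (sym (g-kept k p)) (ℤₚ.≤-trans (orderPreserving f k≤l) (f≤g l))
    ... | yes p with fun f k ℤₚ.≟ fun f l
    ...   | yes q = ℤₚ.≤-reflexive (trans (g-raised k p) (trans (cong (_+ 1ℤ) q) (sym (g-raised l
      (trans (cong r (sym q)) (proj₁ p) , ℤₚ.<-≤-trans (subst (_< k) q (proj₂ p)) k≤l)))))
    ...   | no q  = subst (_≤ g l) (sym (g-raised k p))
      (ℤₚ.≤-trans (i<j⇒i+1≤j (ℤₚ.≤∧≢⇒< (orderPreserving f k≤l) q)) (f≤g l))

    raised-shift : ∀ k → Raised k → Raised (k + + N)
    raised-shift k (p , q) = trans (cong r (NDPF.skewPeriodic f k)) (trans (residue-+N (fun f k)) p) ,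
      subst (_< k + + N) (sym (NDPF.skewPeriodic f k)) (ℤₚ.+-monoˡ-< (+ N) q)

    raised-unshift : ∀ k → Raised (k + + N) → Raised k
    raised-unshift k (p , q) = trans (sym (residue-+N (fun f k))) (trans (cong r (sym (NDPF.skewPeriodic f k))) p) ,
      +-cancelʳ-< (+ N) (subst (_< k + + N) (NDPF.skewPeriodic f k) q)

    g-skewPeriodic : SkewPeriodic N g
    g-skewPeriodic k with raised? k
    ... | yes p = trans (g-raised (k + + N) (raised-shift k p))
      (trans (cong (_+ 1ℤ) (NDPF.skewPeriodic f k))
        (trans (i+j+k≡i+k+j (fun f k) (+ N) 1ℤ) (cong (_+ + N) (sym (g-raised k p)))))
    ... | no p  = trans (g-kept (k + + N) (p ∘ raised-unshift k))
      (trans (NDPF.skewPeriodic f k) (cong (_+ + N) (sym (g-kept k p))))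

    g-notShift : ∀ t → t ≢ 0ℤ → ¬ IsShift t g
    g-notShift t t≢0 sh with raised? (b - 1ℤ)
      | trans (sh (b - 1ℤ)) (trans (i+j+k≡i+k+j b (- 1ℤ) (- t))
          (trans (cong (_- 1ℤ) (trans (sym (sh b)) (g-raised b b-raised))) (i+1-1≡i (fun f b))))
    ... | yes p | g-pred = next-≢ i (trans (cong next (sym (proj₁ p)))
      (trans (sym (residue-next (fun f (b - 1ℤ)))) (cong r (trans (sym (g-raised (b - 1ℤ) p)) g-pred))))
    ... | no p  | g-pred = t≢0 (trans (sym (ℤₚ.neg-involutive t)) (cong -_ (begin
      - t                     ≡⟨ c b t ⟩
      b - t - b               ≡⟨ cong (_- b) (trans (sym (sh b)) (g-raised b b-raised)) ⟩
      fun f b + 1ℤ - b        ≡⟨ cong (λ z → z + 1ℤ - b) fb≡ ⟩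
      b - 1ℤ + 1ℤ - b         ≡⟨ cong (_- b) (i-1+1≡i b) ⟩
      b - b                   ≡⟨ ℤₚ.+-inverseʳ b ⟩
      0ℤ                      ∎)))
      where
      open ≡-Reasoning
      c : ∀ b t → - t ≡ b - t - b
      c = solve-∀
      f-pred : fun f (b - 1ℤ) ≡ fun f b
      f-pred = trans (sym (g-kept (b - 1ℤ) p)) g-pred
      fb≡ : fun f b ≡ b - 1ℤ
      fb≡ = ℤₚ.≤-antisym (i<j⇒i≤j-1 (proj₂ b-raised))
        (ℤₚ.≮⇒≥ λ lt → p (cong r f-pred , subst (_< b - 1ℤ) (sym f-pred) lt))

    factor : NDPF N
    factor = record
      { fun             = g
      ; regressive      = g-regressive
      ; orderPreserving = g-mono
      ; skewPeriodic    = g-skewPeriodic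
      ; notShift        = g-notShift
      }

  module _ (f : NDPF N) (no-jump : ∀ b → fun f (b + 1ℤ) ≤ fun f b + 1ℤ) where

    private
      F : ℤ → ℤ
      F = fun f

      slow : ∀ n k → F (k + + n) ≤ F k + + n
      slow zero    k = ℤₚ.≤-reflexive (trans (cong F (ℤₚ.+-identityʳ k)) (sym (ℤₚ.+-identityʳ (F k))))
      slow (suc n) k = subst₂ _≤_ (cong F (i+j+1≡i+[1+j] k (+ n))) (i+j+1≡i+[1+j] (F k) (+ n))
        (ℤₚ.≤-trans (no-jump (k + + n)) (ℤₚ.+-monoˡ-≤ 1ℤ (slow n k)))

      displacement-constant : ∀ k l → F l - l ≤ F k - k
      displacement-constant k l = subst₂ _≤_
        (trans (cong (_- (l + K)) (skewPeriodic-* F (NDPF.skewPeriodic f) M l)) (c (F l) l K))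
        (trans (cong (_-_ (F k + n)) l+K≡) (c′ (F k) k n))
        (ℤₚ.+-monoˡ-≤ (- (l + K)) (subst (λ z → F z ≤ F k + n) (sym l+K≡) (slow ∣ l + K - k ∣ k)))
        where
        M = + ∣ k - l ∣
        K = M * + N
        n = + ∣ l + K - k ∣
        l+K≡ : l + K ≡ k + n
        l+K≡ = i≤j⇒j≡i+∣j-i∣ (i≤j+∣i-j∣*N k l)
        c : ∀ a l k → a + k - (l + k) ≡ a - l
        c = solve-∀
        c′ : ∀ a k n → a + n - (k + n) ≡ a - k
        c′ = solve-∀

      shift : IsShift (- F 0ℤ) F
      shift k = trans (sym (i-j+j≡i (F k) k)) (trans (cong (_+ k)
        (ℤₚ.≤-antisym (displacement-constant 0ℤ k) (displacement-constant k 0ℤ))) (c (F 0ℤ) k))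
        where
        c : ∀ a k → a - 0ℤ + k ≡ k - (- a)
        c = solve-∀

    no-jump⇒id : ∀ k → fun f k ≡ k
    no-jump⇒id k with - F 0ℤ ℤₚ.≟ 0ℤ
    ... | yes p = trans (shift k) (trans (cong (λ z → k - z) p) (ℤₚ.+-identityʳ k))
    ... | no p  = ⊥-elim (notShift f _ p shift)

  jump? : ∀ (f : NDPF N) → Dec (∃ λ k → k ℕ.< N × fun f (+ suc k) + 1ℤ < fun f (+ suc k + 1ℤ))
  jump? f = ℕₚ.anyUpTo? (λ k → fun f (+ suc k) + 1ℤ ℤₚ.<? fun f (+ suc k + 1ℤ)) N

  generated : ∀ n (f : NDPF N) → excess (fun f) ≤ + n → ∃ λ u → fun (evaluate u) ≗ fun f
  generated n f ≤n with jump? f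
  ... | no none = [] , sym ∘ no-jump⇒id f no-jump
    where
    no-jump : ∀ b → fun f (b + 1ℤ) ≤ fun f b + 1ℤ
    no-jump b with period-representative b
    ... | k , n , k<N , refl = subst₂ _≤_
      (sym (trans (cong (fun f) (i+j+k≡i+k+j (+ suc k) (n * + N) 1ℤ)) (per (+ suc k + 1ℤ))))
      (sym (trans (cong (_+ 1ℤ) (per (+ suc k))) (i+j+k≡i+k+j (fun f (+ suc k)) (n * + N) 1ℤ)))
      (ℤₚ.+-monoˡ-≤ (n * + N) (ℤₚ.≮⇒≥ λ lt → none (k , k<N , lt)))
      where
      per : ∀ i → fun f (i + n * + N) ≡ fun f i + n * + N
      per = skewPeriodic-* (fun f) (NDPF.skewPeriodic f) n
  ... | yes (k , k<N , jump) = descend n ≤n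
    where
    open Factor f (+ suc k) jump
    smaller : excess g < excess (fun f)
    smaller = ∑-mono-< N (λ l → ℤₚ.+-monoʳ-≤ (+ suc l) (ℤₚ.neg-mono-≤ (f≤g (+ suc l)))) k<N
      (ℤₚ.+-monoʳ-< (+ suc k) (ℤₚ.neg-mono-< (subst (fun f (+ suc k) <_) (sym (g-raised (+ suc k) b-raised)) (i<i+1 _))))
    nonneg : 0ℤ ≤ excess g
    nonneg = subst (_≤ excess g) (∑-zero N {λ _ → 0ℤ} λ _ _ → refl)
      (∑-mono-≤ N {λ _ → 0ℤ} λ l → ℤₚ.i≤j⇒0≤j-i (g-regressive (+ suc l)))
    descend : ∀ n → excess (fun f) ≤ + n → ∃ λ u → fun (evaluate u) ≗ fun f
    descend zero    ≤0 = ⊥-elim (ℤₚ.<⇒≱ smaller (ℤₚ.≤-trans ≤0 nonneg))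
    descend (suc n) ≤n with generated n factor
      (i<j+1⇒i≤j (subst (excess g <_) (ℤₚ.+-comm 1ℤ (+ n)) (ℤₚ.<-≤-trans smaller ≤n)))
    ... | u , e = i ∷ u , λ k → trans (cong (lower i) (e k)) (lower-g k)

  evaluate-surjective : ∀ (f : NDPF N) → ∃ λ u → fun (evaluate u) ≗ fun f
  evaluate-surjective f = generated ∣ excess (fun f) ∣ f (i≤∣i∣ (excess (fun f)))

  normalForm : ∀ u → ∃ λ t → Normal t × t ~ u
  normalForm u = let t , n , t~u , _ = normalize (length u) u ℕₚ.≤-refl in t , n , t~u

  word-unique : ∀ {f} → SkewPeriodic N f → ∀ x → Avoids (perm x) → SuffixMinimum (perm x) f → ∀ {t} → Normal t →
    fun (evaluate t) ≗ f → wordPermutation t ≈ₐ x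
  word-unique {f} per x av sm {t} n t≗f = avoiding-unique per (wordPermutation t) x
    (λ {a} → normal-avoids n {a}) (λ {a} → av {a}) sm-t sm
    where
    sm-t : SuffixMinimum (wordProduct t) f
    sm-t with normal-suffixMinimum n
    ... | lb , att = (λ {k} k≤m → subst (_≤ _) (t≗f k) (lb k≤m)) ,
      λ k → let m , k≤m , e = att k in m , k≤m , trans (sym (t≗f k)) e

  evaluate-injective : ∀ {u v} → fun (evaluate u) ≗ fun (evaluate v) → u ~ v
  evaluate-injective {u} {v} e with normalForm u | normalForm v
  ... | s , ns , s~u | t , nt , t~v = ~-trans (~-sym s~u) (~-trans (normal-unique s t ns nt
    (word-unique (NDPF.skewPeriodic (evaluate t)) (wordPermutation t)
      (λ {a} → normal-avoids nt {a}) (normal-suffixMinimum nt) ns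
      λ k → trans (evaluate-cong s~u k) (trans (e k) (sym (evaluate-cong t~v k))))) t~v)

  evaluate-isomorphism : MonoidMorphisms.IsMonoidIsomorphism
    (Monoid.rawMonoid (H₀/extra N)) (Monoid.rawMonoid (NDPF-monoid N)) evaluate
  evaluate-isomorphism = record
    { isMonoidMonomorphism = record
      { isMonoidHomomorphism = record
        { isMagmaHomomorphism = record
          { isRelHomomorphism = record { cong = evaluate-cong }
          ; homo              = evaluate-++
          }
        ; ε-homo = λ _ → refl
        }
      ; injective = evaluate-injective
      }
    ; surjective = λ f → let u , e = evaluate-surjective f in
        u , λ v~u k → trans (evaluate-cong v~u k) (e k)
    }

  ndpf-J-trivial : J-Trivial (NDPF-monoid N)
  ndpf-J-trivial f g (f⊆g , g⊆f) k =
    ℤₚ.≤-antisym (below {f} {g} (λ {h} → f⊆g {h}) k) (below {g} {f} (λ {h} → g⊆f {h}) k)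
    where
    below : ∀ {f g : NDPF N} → (∀ {h} → twoSidedIdeal (NDPF-monoid N) f h → twoSidedIdeal (NDPF-monoid N) g h) →
      ∀ k → fun f k ≤ fun g k
    below {f} {g} f⊆g k with f⊆g {f} (ε , ε , λ _ → refl)
    ... | a , b , e = subst (_≤ fun g k) (sym (e k))
      (ℤₚ.≤-trans (regressive a (fun g (fun b k))) (orderPreserving g (regressive b k)))

  hecke-word : ∀ u → u ≡ foldr (λ i → π N i ++_) [] u
  hecke-word []      = refl
  hecke-word (i ∷ u) = cong (i ∷_) (hecke-word u)

  unique-avoiding : ∀ q → ∃! _≈ₐ_ λ x → Fiber N q x × Avoids321 x
  unique-avoiding q with normalForm q
  ... | t , n , t~q = wordPermutation t ,
    ((t , (t , ((λ _ → refl) , λ v → normal-shortest n v) , base (hecke-word t)) , t~q) ,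
     λ (a , b , d , a<b , b<d , d↓b , b↓a) → normal-avoids n a<b b<d d↓b b↓a) ,
    λ {x} ((h , (u , (u≗x , sh) , h~u) , h~q) , av) →
      word-unique (NDPF.skewPeriodic (evaluate u)) x
        (λ {a} {b} {d} a<b b<d d↓b b↓a → av (a , b , d , a<b , b<d , d↓b , b↓a))
        (suffixMinimum-cong u≗x (shortest-suffixMinimum u λ v v≗u → sh v λ k → trans (v≗u k) (u≗x k)))
        n (evaluate-cong (~-trans t~q (~-trans (~-sym h~q)
            (~-trans (base h~u) (base (base (sym (hecke-word u))))))))
    where
    suffixMinimum-cong : ∀ {x y f} → x ≗ y → SuffixMinimum x f → SuffixMinimum y f
    suffixMinimum-cong {x} {y} {f} x≗y (lb , att) = (λ {k} {m} k≤m → subst (f k ≤_) (x≗y m) (lb k≤m)) ,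
      λ k → let m , k≤m , e = att k in m , k≤m , trans e (x≗y m)

open import Data.Nat.Base using (_≤_)

mainTheorem4 : ∀ (N : ℕ) .{{_ : NonZero N}} → 3 ≤ N →
    J-Trivial (NDPF-monoid N)
    × (H₀/extra N ≅ NDPF-monoid N)
    × (∀ (q : Monoid.Carrier (H₀/extra N)) →
    ∃! _≈ₐ_ (λ (x : AffinePermutation N) → Fiber N q x × Avoids321 x))
mainTheorem4 N 3≤N = ndpf-J-trivial , (evaluate , evaluate-isomorphism) , unique-avoiding
  where open Presentation N 3≤N
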